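{- There exists a constant $c>0$ such that for all sufficiently large $n\in\mathbb{N}$ there exists an $n$-vertex $3$-uniform generalised hedgehog $H^*$ with \[R(H^*)\ \ge\ c\,\frac{n^{3/2}}{\log n}.\] In particular, $H^*$ is a $1$-degenerate $3$-uniform hypergraph on $n$ vertices whose $2$-colour Ramsey number is not $O(n)$.
   Context: A $3$-graph is a $3$-uniform hypergraph. For $3$-graphs $G,H$, the ($2$-colour) Ramsey number $R(G,H)$ is the least $N$ such that every colouring of the edges of the complete $3$-graph on $N$ vertices with red and blue contains a blue copy of $G$ or a red copy of $H$; $R(G)=R(G,G)$. The degree of a vertex is the number of edges containing it; a hypergraph is $D$-degenerate if every subhypergraph has a vertex of degree at most $D$ in that subhypergraph. A (generalised) hedgehog is a $3$-graph on vertex set $B\sqcup S$ ($B$ the body, $S$ the spikes) in which every edge consists of one spike and two body vertices, and every spike lies in exactly one edge (different spikes may be attached to the same pair of body vertices, and some pairs of body vertices may have no spike). Every generalised hedgehog is $1$-degenerate. -}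

module Defs where

open import Data.Nat as ℕ using (ℕ; _≤_; _^_)
open import Data.Integer as ℤ using (+_)
open import Data.Rational.Unnormalised as ℚᵘ using (ℚᵘ; NonNegative; ↥_; ↧ₙ_)
open import Data.Fin using (Fin)
open import Data.Fin.Properties using (any?) renaming (_≟_ to _≟ᶠ_)
open import Data.Fin.Subset using (Subset; ∣_∣; _∩_; ∁; _⊆_; _∈_; _∉_; Nonempty)
open import Data.Fin.Subset.Properties using (_∈?_)
open import Data.List using (List; length; filter)
open import Data.List.Relation.Unary.All using (All)
open import Data.List.Relation.Unary.Unique.Propositional using (Unique)
import Data.List.Relation.Binary.Subset.Propositional as List
open import Data.Product using (Σ; ∃; _×_)
open import Data.Sum using (_⊎_)
open import Data.Vec using (tabulate)
open import Function.Definitions using (Injective)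
open import Relation.Binary.PropositionalEquality using (_≡_)
open import Relation.Nullary.Decidable using (does; _×-dec_)

record ThreeGraph (n : ℕ) : Set where
  field
    edges   : List (Subset n)
    unique  : Unique edges
    uniform : All (λ e → ∣ e ∣ ≡ 3) edges

open ThreeGraph public

-- Counts list entries, so this is the degree only for duplicate-free lists.
degree : ∀ {n} → List (Subset n) → Fin n → ℕ
degree es v = length (filter (v ∈?_) es)

record Subhypergraph {n : ℕ} (G : ThreeGraph n) : Set where
  field
    vertices  : Subset n
    subEdges  : List (Subset n)
    subUnique : Unique subEdges
    fromG     : subEdges List.⊆ edges G
    within    : All (_⊆ vertices) subEdges

open Subhypergraph public

-- The subhypergraph with no vertices is excluded, as it has no vertex at all.
Degenerate : ∀ {n} → ℕ → ThreeGraph n → Set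
Degenerate D G =
  (K : Subhypergraph G) → Nonempty (vertices K) →
  ∃ λ v → v ∈ vertices K × degree (subEdges K) v ≤ D

-- The spikes are the complement of the body.
record IsGeneralisedHedgehog {n : ℕ} (G : ThreeGraph n) : Set where
  field
    body      : Subset n
    edgeShape : All (λ e → ∣ e ∩ ∁ body ∣ ≡ 1 × ∣ e ∩ body ∣ ≡ 2) (edges G)
    spikeOnce : ∀ v → v ∉ body → degree (edges G) v ≡ 1

data Colour : Set where
  red blue : Colour

-- Only the values on 3-element subsets, the edges of the complete 3-graph,
-- are ever used; the values on other subsets are irrelevant.
Colouring : ℕ → Set
Colouring N = Subset N → Colour

image : ∀ {n N} → (Fin n → Fin N) → Subset n → Subset N
image f e = tabulate λ y → does (any? λ x → (x ∈? e) ×-dec (f x ≟ᶠ y))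

Copy : ∀ {n N} → Colour → Colouring N → ThreeGraph n → Set
Copy {n} {N} k χ G =
  Σ (Fin n → Fin N) λ f →
    Injective _≡_ _≡_ f × All (λ e → χ (image f e) ≡ k) (edges G)

Arrows : ∀ {m n} → ℕ → ThreeGraph m → ThreeGraph n → Set
Arrows N G H = (χ : Colouring N) → Copy blue χ G ⊎ Copy red χ H

IsRamseyNumber : ∀ {m n} → ThreeGraph m → ThreeGraph n → ℕ → Set
IsRamseyNumber G H R = Arrows R G H × (∀ N → Arrows N G H → R ≤ N)

-- For rational s ≥ 0, the real inequality s ≤ n^(3/2), squared.
_≤_^3/2 : ℚᵘ → ℕ → Set
s ≤ n ^3/2 = s ℚᵘ.* s ℚᵘ.≤ (+ (n ^ 3)) ℚᵘ./ 1

-- For s = a / b ≥ 0 and m ≥ 1, the real inequality s ≤ log₂ m, i.e. 2^a ≤ m^b.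
_≤log₂_ : ℚᵘ → ℕ → Set
s ≤log₂ m = 2 ^ ℤ.∣ ↥ s ∣ ≤ m ^ ↧ₙ s

-- For n ≥ 2 and rational c > 0, exactly the real inequality
--   c · n^(3/2) / log₂ n ≤ R,
-- i.e. c · n^(3/2) ≤ R · log₂ n = log₂ (n^R): by density of the rationals it
-- holds iff c · s ≤ log₂ (n^R) for every rational s with 0 ≤ s ≤ n^(3/2).
LowerBound : ℚᵘ → ℕ → ℕ → Set
LowerBound c n R =
  (s : ℚᵘ) → NonNegative s → s ≤ n ^3/2 → (c ℚᵘ.* s) ≤log₂ (n ^ R)

-- A natural constant suffices: every real constant is below a natural one.
IsO[n] : (ℕ → ℕ) → Set
IsO[n] f = ∃ λ C → ∃ λ n₁ → ∀ n → n₁ ≤ n → f n ≤ C ℕ.* n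

{-# OPTIONS --safe #-}

-- Let Γ be a graph on N ≈ n^(3/2) / log n vertices with maximum degree below
-- Δ = εn, without independent sets of size k ≈ √n and without cliques of
-- size t = 12; a random graph of density about log n / √n is such a Γ. Colour
-- a triple red when it contains an edge of Γ, and blue otherwise. In the
-- hedgehog every pair of the k body vertices carries a spike, so the body of a
-- blue copy would be an independent set. Moreover every pair among t of the
-- body vertices carries 2Δ spikes. In a red copy some such pair is not an edge
-- of Γ, so all its spikes are Γ-neighbours of its two vertices, which have too
-- few neighbours.
module Submission where

open import Defs
open import Data.Bool using (Bool; true; false; not; _∧_; if_then_else_)
open import Data.Fin using (Fin; zero; suc; _↑ˡ_; _↑ʳ_; splitAt; combine; remQuot; inject≤)
open import Data.Fin.Properties using (any?; all?; ↑ˡ-injective; ↑ʳ-injective; splitAt-↑ˡ; splitAt-↑ʳ; splitAt⁻¹-↑ˡ; splitAt⁻¹-↑ʳ; remQuot-combine; combine-injectiveˡ; inject≤-injective) renaming (_≟_ to _≟ᶠ_)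
open import Data.Fin.Subset using (Subset; ∣_∣; _∈_; _∉_; _∪_; _∩_; ∁; ⊥; ⊤; ⁅_⁆)
open import Data.Fin.Subset.Properties using (_∈?_; ⊆-antisym; ∉⊥; ∈⊤; ∣⊥∣≡0; ∣⁅x⁆∣≡1; x∈⁅x⁆; x∈⁅y⁆⇒x≡y; x≢y⇒x∉⁅y⁆; x∈p∪q⁺; x∈p∪q⁻; p⊆q⇒∣p∣≤∣q∣; ∪-identityˡ; ∩-identityʳ; ∩-zeroʳ)
open import Data.Integer as ℤ using (-[1+_])
import Data.Integer.Properties as ℤ
open import Data.List using (List; []; _∷_; map; length; foldr; take; allFin; tabulate) renaming (_++_ to _++ˡ_; lookup to lookupˡ)
open import Data.List.Properties using (length-map; length-++; length-take; length-tabulate; map-tabulate; tabulate-lookup; filter-none)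
open import Data.List.Membership.Propositional using () renaming (_∈_ to _∈ˡ_)
open import Data.List.Membership.Propositional.Properties using (∈-map⁺; ∈-map⁻; ∈-++⁺ˡ; ∈-++⁺ʳ; ∈-allFin; ∈-lookup; ∈-tabulate⁺; ∈-tabulate⁻; ∈-filter⁺; ∈-filter⁻; ∈-length)
open import Data.List.Relation.Binary.Sublist.Propositional using ([]; _∷_; _∷ʳ_; minimum; ⊆-trans; ⊆-reflexive) renaming (_⊆_ to _⊑_)
open import Data.List.Relation.Binary.Sublist.Propositional.Properties using (map⁺; take-⊆; All-resp-⊆)
open import Data.List.Relation.Unary.All as All using (All; []; _∷_)
import Data.List.Relation.Unary.All.Properties as All
open import Data.List.Relation.Unary.AllPairs using ([]; _∷_)
open import Data.List.Relation.Unary.Any using (here; there)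
open import Data.List.Relation.Unary.Unique.Propositional using (Unique)
import Data.List.Relation.Unary.Unique.Propositional.Properties as Unique
open import Data.Nat using (ℕ; zero; suc; _+_; _*_; _^_; _≤_; _<_; _≤?_; z≤n; s≤s; NonZero; >-nonZero)
open import Data.Nat.ListAction using (sum)
open import Data.Nat.Properties
open import Data.Nat.Tactic.RingSolver using (solve-∀)
open import Data.Product as Product using (Σ; ∃; _×_; _,_; proj₁; proj₂)
open import Data.Rational.Unnormalised using (ℚᵘ; Positive; mkℚᵘ; *≤*)
open import Data.Sum as Sum using (_⊎_; inj₁; inj₂; [_,_]′)
open import Data.Unit using (tt) renaming (⊤ to Unit)
open import Data.Vec using (Vec; []; _∷_; _++_; lookup; here; there)
open import Data.Vec.Functional using () renaming (_∷_ to _∷ᶠ_)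
open import Data.Vec.Properties using ([]=⇒lookup; lookup⇒[]=; lookup∘tabulate; zipWith-++; map-++; map-replicate)
open import Function using (_∘_; id; const)
open import Function.Definitions using (Injective)
open import Relation.Binary.PropositionalEquality using (_≡_; _≢_; _≗_; refl; sym; trans; cong; cong₂; subst; subst₂)
open import Relation.Nullary using (Dec; yes; no; ¬_; contradiction; does)
open import Relation.Nullary.Decidable using (_×-dec_; _⊎-dec_; _→-dec_; ¬?; map′; decidable-stable; dec-true; dec-false; toWitness)

-- Sparse graphs without large homogeneous sets

-- The orders of magnitude are forced by the budget of n vertices. A spike on each pair of body
-- vertices costs about k² vertices and the heavy pairs cost about 2Δt², so k is O(√n), Δ is O(n)
-- and t has to be a constant. To lose its independent sets of size k a random graph needs density
-- about log n / k, and degrees below Δ then allow N ≈ Δk / log n vertices, which is the claimed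
-- order. A constant t suffices because N is polynomial in the inverse q of the density: for N ≤ q⁵
-- the expected number of cliques of size t is at most q^(5t - t(t-1)/2), which is tiny for t = 12.
-- A second obstacle is that the theorem asks for the Ramsey numbers themselves, as a function. They
-- are constructed: a finite Ramsey theorem gives some order that arrows, and as the arrow relation
-- is decidable, the least such order is found by search. All probabilistic estimates are multiplied
-- out to inequalities between natural numbers.

-- A graph on Fin n: the upper triangle of its adjacency matrix, row by row.
Graph : ℕ → Set
Graph zero    = Unit
Graph (suc n) = Vec Bool n × Graph n

neighbours : ∀ {n} → Graph n → Fin n → Subset n
neighbours (r , g) zero    = false ∷ r
neighbours (r , g) (suc i) = lookup r i ∷ neighbours g i

neighbours-sym : ∀ {n} (g : Graph n) {x y} → x ∈ neighbours g y → y ∈ neighbours g x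
neighbours-sym (r , g) {zero}  {suc y} x∈ = there (lookup⇒[]= y r ([]=⇒lookup x∈))
neighbours-sym (r , g) {suc x} {zero}  (there x∈) = subst (λ b → zero ∈ b ∷ neighbours g x) (sym ([]=⇒lookup x∈)) here
neighbours-sym (r , g) {suc x} {suc y} (there x∈) = there (neighbours-sym g x∈)

pairs : ℕ → ℕ
pairs zero    = 0
pairs (suc n) = n + pairs n

matches : Bool → Bool → ℕ
matches true  true  = 1
matches false false = 1
matches _     _     = 0

rowHom : ∀ {n} → Bool → Subset n → Vec Bool n → ℕ
rowHom c []          []      = 1
rowHom c (true  ∷ S) (x ∷ r) = matches c x * rowHom c S r
rowHom c (false ∷ S) (x ∷ r) = rowHom c S r

-- The indicator of: S is a clique (c = true), or an independent set (c = false).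
homogeneous : ∀ {n} → Bool → Subset n → Graph n → ℕ
homogeneous c []          tt      = 1
homogeneous c (true  ∷ S) (r , g) = rowHom c S r * homogeneous c S g
homogeneous c (false ∷ S) (r , g) = homogeneous c S g

rowHom≡1 : ∀ {n} c (S : Subset n) r → (∀ {y} → y ∈ S → lookup r y ≡ c) → rowHom c S r ≡ 1
rowHom≡1 c     []          []      _ = refl
rowHom≡1 c     (false ∷ S) (x ∷ r) h = rowHom≡1 c S r λ y∈ → h (there y∈)
rowHom≡1 c     (true  ∷ S) (x ∷ r) h with h here
rowHom≡1 true  (true  ∷ S) (x ∷ r) h | refl = trans (*-identityˡ _) (rowHom≡1 true S r λ y∈ → h (there y∈))
rowHom≡1 false (true  ∷ S) (x ∷ r) h | refl = trans (*-identityˡ _) (rowHom≡1 false S r λ y∈ → h (there y∈))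

homogeneous≡1 : ∀ {n} c (S : Subset n) g →
  (∀ {x y} → x ∈ S → y ∈ S → x ≢ y → lookup (neighbours g x) y ≡ c) → homogeneous c S g ≡ 1
homogeneous≡1 c []          tt      _ = refl
homogeneous≡1 c (false ∷ S) (r , g) h = homogeneous≡1 c S g λ x∈ y∈ x≢y → h (there x∈) (there y∈) λ { refl → x≢y refl }
homogeneous≡1 c (true  ∷ S) (r , g) h = cong₂ _*_
  (rowHom≡1 c S r λ y∈ → h here (there y∈) λ ())
  (homogeneous≡1 c S g λ x∈ y∈ x≢y → h (there x∈) (there y∈) λ { refl → x≢y refl })

record Sparse {n} (k t Δ : ℕ) (g : Graph n) : Set where
  field
    noIndependent : ∀ S → ∣ S ∣ ≡ k → homogeneous false S g ≡ 0
    noClique      : ∀ S → ∣ S ∣ ≡ t → homogeneous true S g ≡ 0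
    maxDegree     : ∀ v → ∣ neighbours g v ∣ < Δ

subsets : ∀ n → ℕ → List (Subset n)
subsets n       zero    = ⊥ ∷ []
subsets zero    (suc k) = []
subsets (suc n) (suc k) = map (true ∷_) (subsets n k) ++ˡ map (false ∷_) (subsets n (suc k))

length-subsets : ∀ n k → length (subsets n k) ≤ n ^ k
length-subsets n       zero    = s≤s z≤n
length-subsets zero    (suc k) = z≤n
length-subsets (suc n) (suc k) = begin
  length (map (true ∷_) (subsets n k) ++ˡ map (false ∷_) (subsets n (suc k)))
    ≡⟨ length-++ (map (true ∷_) (subsets n k)) ⟩
  length (map (true ∷_) (subsets n k)) + length (map (false ∷_) (subsets n (suc k)))
    ≡⟨ cong₂ _+_ (length-map _ (subsets n k)) (length-map _ (subsets n (suc k))) ⟩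
  length (subsets n k) + length (subsets n (suc k))
    ≤⟨ +-mono-≤ (length-subsets n k) (length-subsets n (suc k)) ⟩
  n ^ k + n * n ^ k
    ≤⟨ *-monoʳ-≤ (suc n) (^-monoˡ-≤ k (n≤1+n n)) ⟩
  suc n ^ suc k ∎
  where open ≤-Reasoning

∣subsets∣ : ∀ n k → All (λ S → ∣ S ∣ ≡ k) (subsets n k)
∣subsets∣ n       zero    = ∣⊥∣≡0 n ∷ []
∣subsets∣ zero    (suc k) = []
∣subsets∣ (suc n) (suc k) = All.++⁺ (All.map⁺ (All.map (cong suc) (∣subsets∣ n k))) (All.map⁺ (∣subsets∣ n (suc k)))

∈-subsets : ∀ {n} (S : Subset n) → S ∈ˡ subsets n ∣ S ∣
∈-subsets {zero}  []          = here refl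
∈-subsets {suc n} (true  ∷ S) = ∈-++⁺ˡ (∈-map⁺ (true ∷_) (∈-subsets S))
∈-subsets {suc n} (false ∷ S) with ∣ S ∣ | ∈-subsets S
... | suc k | S∈ = ∈-++⁺ʳ (map (true ∷_) (subsets n k)) (∈-map⁺ (false ∷_) S∈)
... | zero  | here refl = here refl

∈⇒≤sum : ∀ {A : Set} (f : A → ℕ) {x xs} → x ∈ˡ xs → f x ≤ sum (map f xs)
∈⇒≤sum f (here refl) = m≤m+n _ _
∈⇒≤sum f {xs = y ∷ _} (there x∈) = ≤-trans (∈⇒≤sum f x∈) (m≤n+m _ (f y))

-- Expectations, scaled to integers, over graphs whose edges are present
-- independently with probability 1 / q.
module RandomGraph (p : ℕ) where

  q : ℕ
  q = suc p

  -- An entry `true` weighs 1 and an entry `false` weighs `p`. The rows of length `n` thus have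
  -- total weight `q ^ n`, which is the factor by which the true mean is scaled; for graphs it is
  -- `q ^ pairs n`.
  𝔼ʳ : ∀ n → (Vec Bool n → ℕ) → ℕ
  𝔼ʳ zero    f = f []
  𝔼ʳ (suc n) f = 𝔼ʳ n (λ r → f (true ∷ r)) + p * 𝔼ʳ n (λ r → f (false ∷ r))

  𝔼 : ∀ n → (Graph n → ℕ) → ℕ
  𝔼 zero    f = f tt
  𝔼 (suc n) f = 𝔼ʳ n λ r → 𝔼 n λ g → f (r , g)

  𝔼ʳ-cong : ∀ n {f h} → (∀ r → f r ≡ h r) → 𝔼ʳ n f ≡ 𝔼ʳ n h
  𝔼ʳ-cong zero    e = e []
  𝔼ʳ-cong (suc n) e = cong₂ (λ x y → x + p * y) (𝔼ʳ-cong n λ r → e (true ∷ r)) (𝔼ʳ-cong n λ r → e (false ∷ r))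

  𝔼-cong : ∀ n {f h} → (∀ g → f g ≡ h g) → 𝔼 n f ≡ 𝔼 n h
  𝔼-cong zero    e = e tt
  𝔼-cong (suc n) e = 𝔼ʳ-cong n λ r → 𝔼-cong n λ g → e (r , g)

  𝔼ʳ-+ : ∀ n f h → 𝔼ʳ n (λ r → f r + h r) ≡ 𝔼ʳ n f + 𝔼ʳ n h
  𝔼ʳ-+ zero    f h = refl
  𝔼ʳ-+ (suc n) f h = trans
    (cong₂ (λ x y → x + p * y) (𝔼ʳ-+ n (λ r → f (true ∷ r)) λ r → h (true ∷ r)) (𝔼ʳ-+ n (λ r → f (false ∷ r)) λ r → h (false ∷ r)))
    (rearrange (𝔼ʳ n λ r → f (true ∷ r)) (𝔼ʳ n λ r → h (true ∷ r)) (𝔼ʳ n λ r → f (false ∷ r)) (𝔼ʳ n λ r → h (false ∷ r)) p)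
    where
    rearrange : ∀ a b c d p → (a + b) + p * (c + d) ≡ (a + p * c) + (b + p * d)
    rearrange = solve-∀

  𝔼-+ : ∀ n f h → 𝔼 n (λ g → f g + h g) ≡ 𝔼 n f + 𝔼 n h
  𝔼-+ zero    f h = refl
  𝔼-+ (suc n) f h = trans
    (𝔼ʳ-cong n λ r → 𝔼-+ n (λ g → f (r , g)) λ g → h (r , g))
    (𝔼ʳ-+ n (λ r → 𝔼 n λ g → f (r , g)) λ r → 𝔼 n λ g → h (r , g))

  𝔼ʳ-*ˡ : ∀ n c f → 𝔼ʳ n (λ r → c * f r) ≡ c * 𝔼ʳ n f
  𝔼ʳ-*ˡ zero    c f = refl
  𝔼ʳ-*ˡ (suc n) c f = trans
    (cong₂ (λ x y → x + p * y) (𝔼ʳ-*ˡ n c λ r → f (true ∷ r)) (𝔼ʳ-*ˡ n c λ r → f (false ∷ r)))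
    (rearrange c (𝔼ʳ n λ r → f (true ∷ r)) (𝔼ʳ n λ r → f (false ∷ r)) p)
    where
    rearrange : ∀ c a b p → c * a + p * (c * b) ≡ c * (a + p * b)
    rearrange = solve-∀

  𝔼ʳ-*ʳ : ∀ n c f → 𝔼ʳ n (λ r → f r * c) ≡ 𝔼ʳ n f * c
  𝔼ʳ-*ʳ n c f = trans (𝔼ʳ-cong n λ r → *-comm (f r) c) (trans (𝔼ʳ-*ˡ n c f) (*-comm c (𝔼ʳ n f)))

  𝔼-*ˡ : ∀ n c f → 𝔼 n (λ g → c * f g) ≡ c * 𝔼 n f
  𝔼-*ˡ zero    c f = refl
  𝔼-*ˡ (suc n) c f = trans (𝔼ʳ-cong n λ r → 𝔼-*ˡ n c λ g → f (r , g)) (𝔼ʳ-*ˡ n c λ r → 𝔼 n λ g → f (r , g))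

  𝔼-indep : ∀ n (f : Vec Bool n → ℕ) (h : Graph n → ℕ) → 𝔼 (suc n) (λ { (r , g) → f r * h g }) ≡ 𝔼ʳ n f * 𝔼 n h
  𝔼-indep n f h = trans (𝔼ʳ-cong n λ r → 𝔼-*ˡ n (f r) h) (𝔼ʳ-*ʳ n (𝔼 n h) f)

  𝔼ʳ-const : ∀ n c → 𝔼ʳ n (λ _ → c) ≡ q ^ n * c
  𝔼ʳ-const zero    c = sym (+-identityʳ c)
  𝔼ʳ-const (suc n) c rewrite 𝔼ʳ-const n c = sym (*-assoc q (q ^ n) c)

  𝔼-zero : ∀ n → 𝔼 n (λ _ → 0) ≡ 0
  𝔼-zero n = 𝔼-*ˡ n 0 (λ _ → 0)

  -- The smaller of the two values found in the halves is at most their mean with weights 1 and `p`.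
  𝔼ʳ-attained : ∀ n f → ∃ λ r → q ^ n * f r ≤ 𝔼ʳ n f
  𝔼ʳ-attained zero    f = [] , ≤-reflexive (+-identityʳ (f []))
  𝔼ʳ-attained (suc n) f
    with 𝔼ʳ-attained n (λ r → f (true ∷ r)) | 𝔼ʳ-attained n (λ r → f (false ∷ r))
  ... | r₁ , h₁ | r₀ , h₀ with f (true ∷ r₁) ≤? f (false ∷ r₀)
  ... | yes le = true ∷ r₁ , ≤-trans (≤-reflexive (*-assoc q (q ^ n) _))
                   (+-mono-≤ h₁ (*-monoʳ-≤ p (≤-trans (*-monoʳ-≤ (q ^ n) le) h₀)))
  ... | no  gt = false ∷ r₀ , ≤-trans (≤-reflexive (*-assoc q (q ^ n) _))
                   (+-mono-≤ (≤-trans (*-monoʳ-≤ (q ^ n) (≰⇒≥ gt)) h₁) (*-monoʳ-≤ p h₀))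

  -- Method of conditional expectations: fix a first row for which the mean over the remaining rows
  -- is small, then continue with those.
  𝔼-attained : ∀ n f → ∃ λ g → q ^ pairs n * f g ≤ 𝔼 n f
  𝔼-attained zero    f = tt , ≤-reflexive (+-identityʳ (f tt))
  𝔼-attained (suc n) f with 𝔼ʳ-attained n (λ r → 𝔼 n λ g → f (r , g))
  ... | r , h with 𝔼-attained n (λ g → f (r , g))
  ... | g , h′ = (r , g) , (begin
    q ^ (n + pairs n) * f (r , g)       ≡⟨ cong (_* f (r , g)) (^-distribˡ-+-* q n (pairs n)) ⟩
    q ^ n * q ^ pairs n * f (r , g)     ≡⟨ *-assoc (q ^ n) (q ^ pairs n) _ ⟩
    q ^ n * (q ^ pairs n * f (r , g))   ≤⟨ *-monoʳ-≤ (q ^ n) h′ ⟩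
    q ^ n * 𝔼 n (λ g → f (r , g))       ≤⟨ h ⟩
    𝔼 (suc n) f                         ∎)
    where open ≤-Reasoning

  -- Linearity of expectation when every term has the bound b / a, with the denominator cleared.
  𝔼-sum : ∀ n {A : Set} (F : A → Graph n → ℕ) {a b xs} → All (λ x → 𝔼 n (F x) * a ≤ b) xs →
    𝔼 n (λ g → sum (map (λ x → F x g) xs)) * a ≤ length xs * b
  𝔼-sum n F {a} [] rewrite 𝔼-zero n = z≤n
  𝔼-sum n F {a} {b} {x ∷ xs} (px ∷ pxs) = begin
    𝔼 n (λ g → F x g + sum (map (λ x → F x g) xs)) * a
      ≡⟨ cong (_* a) (𝔼-+ n (F x) λ g → sum (map (λ x → F x g) xs)) ⟩
    (𝔼 n (F x) + 𝔼 n (λ g → sum (map (λ x → F x g) xs))) * a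
      ≡⟨ *-distribʳ-+ a (𝔼 n (F x)) _ ⟩
    𝔼 n (F x) * a + 𝔼 n (λ g → sum (map (λ x → F x g) xs)) * a
      ≤⟨ +-mono-≤ px (𝔼-sum n F pxs) ⟩
    b + length xs * b ∎
    where open ≤-Reasoning

  weight : Bool → ℕ
  weight true  = 1
  weight false = p

  -- Each element of `S` prescribes one entry, which has probability `weight c / q`; the entries
  -- outside `S` are free.
  𝔼-rowHom : ∀ {n} c (S : Subset n) → 𝔼ʳ n (rowHom c S) * q ^ ∣ S ∣ ≡ weight c ^ ∣ S ∣ * q ^ n
  𝔼-rowHom c []          = refl
  𝔼-rowHom {suc n} c (true ∷ S) = begin-equality
    (𝔼ʳ n (λ r → matches c true * rowHom c S r) + p * 𝔼ʳ n (λ r → matches c false * rowHom c S r)) * (q * q ^ ∣ S ∣)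
      ≡⟨ cong₂ (λ x y → (x + p * y) * (q * q ^ ∣ S ∣)) (𝔼ʳ-*ˡ n (matches c true) (rowHom c S)) (𝔼ʳ-*ˡ n (matches c false) (rowHom c S)) ⟩
    (matches c true * e + p * (matches c false * e)) * (q * q ^ ∣ S ∣)
      ≡⟨ cong (_* (q * q ^ ∣ S ∣)) (weigh c) ⟩
    weight c * e * (q * q ^ ∣ S ∣)
      ≡⟨ [m*n]*[o*p]≡[m*o]*[n*p] (weight c) e q (q ^ ∣ S ∣) ⟩
    weight c * q * (e * q ^ ∣ S ∣)
      ≡⟨ cong (weight c * q *_) (𝔼-rowHom c S) ⟩
    weight c * q * (weight c ^ ∣ S ∣ * q ^ n)
      ≡⟨ [m*n]*[o*p]≡[m*o]*[n*p] (weight c) q (weight c ^ ∣ S ∣) (q ^ n) ⟩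
    weight c * weight c ^ ∣ S ∣ * (q * q ^ n) ∎
    where
    open ≤-Reasoning
    e : ℕ
    e = 𝔼ʳ n (rowHom c S)
    weigh : ∀ c → matches c true * e + p * (matches c false * e) ≡ weight c * e
    weigh true  = trans (cong (_+_ (e + 0)) (*-zeroʳ p)) (+-identityʳ (e + 0))
    weigh false = cong (p *_) (+-identityʳ e)
  𝔼-rowHom {suc n} c (false ∷ S) = trans (rearrange p (𝔼ʳ n (rowHom c S)) (q ^ ∣ S ∣))
    (trans (cong (q *_) (𝔼-rowHom c S)) (swap q (weight c ^ ∣ S ∣) (q ^ n)))
    where
    rearrange : ∀ p e s → (e + p * e) * s ≡ suc p * (e * s)
    rearrange = solve-∀
    swap : ∀ a b c → a * (b * c) ≡ b * (a * c)
    swap = solve-∀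

  𝔼-homogeneous : ∀ {n} c (S : Subset n) →
    𝔼 n (homogeneous c S) * q ^ pairs ∣ S ∣ ≡ weight c ^ pairs ∣ S ∣ * q ^ pairs n
  𝔼-homogeneous c [] = refl
  𝔼-homogeneous {suc n} c (true ∷ S) = begin-equality
    𝔼 (suc n) (homogeneous c (true ∷ S)) * q ^ (∣ S ∣ + pairs ∣ S ∣)
      ≡⟨ cong₂ _*_ (𝔼-indep n (rowHom c S) (homogeneous c S)) (^-distribˡ-+-* q ∣ S ∣ (pairs ∣ S ∣)) ⟩
    𝔼ʳ n (rowHom c S) * 𝔼 n (homogeneous c S) * (q ^ ∣ S ∣ * q ^ pairs ∣ S ∣)
      ≡⟨ [m*n]*[o*p]≡[m*o]*[n*p] (𝔼ʳ n (rowHom c S)) (𝔼 n (homogeneous c S)) (q ^ ∣ S ∣) (q ^ pairs ∣ S ∣) ⟩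
    𝔼ʳ n (rowHom c S) * q ^ ∣ S ∣ * (𝔼 n (homogeneous c S) * q ^ pairs ∣ S ∣)
      ≡⟨ cong₂ _*_ (𝔼-rowHom c S) (𝔼-homogeneous c S) ⟩
    weight c ^ ∣ S ∣ * q ^ n * (weight c ^ pairs ∣ S ∣ * q ^ pairs n)
      ≡⟨ [m*n]*[o*p]≡[m*o]*[n*p] (weight c ^ ∣ S ∣) (q ^ n) (weight c ^ pairs ∣ S ∣) (q ^ pairs n) ⟩
    weight c ^ ∣ S ∣ * weight c ^ pairs ∣ S ∣ * (q ^ n * q ^ pairs n)
      ≡⟨ cong₂ _*_ (^-distribˡ-+-* (weight c) ∣ S ∣ (pairs ∣ S ∣)) (^-distribˡ-+-* q n (pairs n)) ⟨
    weight c ^ (∣ S ∣ + pairs ∣ S ∣) * q ^ (n + pairs n) ∎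
    where
    open ≤-Reasoning
  𝔼-homogeneous {suc n} c (false ∷ S) = begin-equality
    𝔼ʳ n (λ _ → 𝔼 n (homogeneous c S)) * q ^ pairs ∣ S ∣
      ≡⟨ cong (_* q ^ pairs ∣ S ∣) (𝔼ʳ-const n (𝔼 n (homogeneous c S))) ⟩
    q ^ n * 𝔼 n (homogeneous c S) * q ^ pairs ∣ S ∣
      ≡⟨ *-assoc (q ^ n) _ _ ⟩
    q ^ n * (𝔼 n (homogeneous c S) * q ^ pairs ∣ S ∣)
      ≡⟨ cong (q ^ n *_) (𝔼-homogeneous c S) ⟩
    q ^ n * (weight c ^ pairs ∣ S ∣ * q ^ pairs n)
      ≡⟨ swap (q ^ n) (weight c ^ pairs ∣ S ∣) (q ^ pairs n) ⟩
    weight c ^ pairs ∣ S ∣ * (q ^ n * q ^ pairs n)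
      ≡⟨ cong (weight c ^ pairs ∣ S ∣ *_) (^-distribˡ-+-* q n (pairs n)) ⟨
    weight c ^ pairs ∣ S ∣ * q ^ (n + pairs n) ∎
    where
    open ≤-Reasoning
    swap : ∀ a b c → a * (b * c) ≡ b * (a * c)
    swap = solve-∀

  2^bit : Bool → ℕ
  2^bit b = if b then 2 else 1

  2^∣x∷S∣ : ∀ {n} x (S : Subset n) → 2 ^ ∣ x ∷ S ∣ ≡ 2^bit x * 2 ^ ∣ S ∣
  2^∣x∷S∣ true  S = refl
  2^∣x∷S∣ false S = sym (+-identityʳ _)

  𝔼-2^∣row∣ : ∀ n → 𝔼ʳ n (λ r → 2 ^ ∣ r ∣) ≡ suc q ^ n
  𝔼-2^∣row∣ zero    = refl
  𝔼-2^∣row∣ (suc n) = trans (cong₂ (λ x y → x + p * y) (𝔼ʳ-*ˡ n 2 λ r → 2 ^ ∣ r ∣) refl)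
    (trans (cong (λ x → 2 * x + p * x) (𝔼-2^∣row∣ n)) (rearrange (suc q ^ n) p))
    where
    rearrange : ∀ x p → 2 * x + p * x ≡ suc (suc p) * x
    rearrange = solve-∀

  𝔼-2^bit : ∀ n (i : Fin (suc n)) → 𝔼ʳ (suc n) (λ r → 2^bit (lookup r i)) ≡ suc q * q ^ n
  𝔼-2^bit n zero = trans (cong₂ (λ x y → x + p * y) (𝔼ʳ-const n 2) (𝔼ʳ-const n 1)) (rearrange (q ^ n) p)
    where
    rearrange : ∀ x p → x * 2 + p * (x * 1) ≡ suc (suc p) * x
    rearrange = solve-∀
  𝔼-2^bit (suc n) (suc i) = trans (cong (λ x → x + p * x) (𝔼-2^bit n i)) (rearrange (q ^ n) p)
    where
    rearrange : ∀ x p → suc (suc p) * x + p * (suc (suc p) * x) ≡ suc (suc p) * (suc p * x)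
    rearrange = solve-∀

  -- The degree of `v` is a sum of independent bits, one in each earlier row and the rest in the row
  -- of `v`, and 2 to the power of a bit has mean (q + 1) / q.
  𝔼-2^degree : ∀ {n} (v : Fin n) → 𝔼 n (λ g → 2 ^ ∣ neighbours g v ∣) * q ^ n ≤ suc q ^ n * q ^ pairs n
  𝔼-2^degree {suc n} zero = begin
    𝔼 (suc n) (λ g → 2 ^ ∣ neighbours g zero ∣) * q ^ suc n
      ≡⟨ cong (_* q ^ suc n) (trans (𝔼ʳ-cong n λ r → 𝔼-const n (2 ^ ∣ r ∣)) (𝔼ʳ-*ˡ n (q ^ pairs n) λ r → 2 ^ ∣ r ∣)) ⟩
    q ^ pairs n * 𝔼ʳ n (λ r → 2 ^ ∣ r ∣) * q ^ suc n
      ≡⟨ cong (λ x → q ^ pairs n * x * q ^ suc n) (𝔼-2^∣row∣ n) ⟩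
    q ^ pairs n * suc q ^ n * (q * q ^ n)
      ≡⟨ rearrange (q ^ pairs n) (suc q ^ n) q (q ^ n) ⟩
    q * suc q ^ n * (q ^ n * q ^ pairs n)
      -- Only `n` bits occur for `suc n` vertices, as a vertex is not its own neighbour; one more
      -- factor (q + 1) / q is given away for a uniform exponent.
      ≤⟨ *-monoˡ-≤ (q ^ n * q ^ pairs n) (*-monoˡ-≤ (suc q ^ n) (n≤1+n q)) ⟩
    suc q * suc q ^ n * (q ^ n * q ^ pairs n)
      ≡⟨ cong (suc q ^ suc n *_) (^-distribˡ-+-* q n (pairs n)) ⟨
    suc q ^ suc n * q ^ (n + pairs n) ∎
    where
    open ≤-Reasoning
    𝔼-const : ∀ n c → 𝔼 n (λ _ → c) ≡ q ^ pairs n * c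
    𝔼-const zero    c = sym (+-identityʳ c)
    𝔼-const (suc n) c = trans (𝔼ʳ-cong n λ _ → 𝔼-const n c) (trans (𝔼ʳ-const n (q ^ pairs n * c))
      (trans (sym (*-assoc (q ^ n) (q ^ pairs n) c)) (cong (_* c) (sym (^-distribˡ-+-* q n (pairs n))))))
    rearrange : ∀ a b c d → a * b * (c * d) ≡ c * b * (d * a)
    rearrange = solve-∀
  𝔼-2^degree {suc (suc n)} (suc v) = begin
    𝔼 (2 + n) (λ g → 2 ^ ∣ neighbours g (suc v) ∣) * q ^ (2 + n)
      ≡⟨ cong (_* q ^ (2 + n)) (𝔼-cong (2 + n) λ { (r , g) → 2^∣x∷S∣ (lookup r v) (neighbours g v) }) ⟩
    𝔼 (2 + n) (λ { (r , g) → 2^bit (lookup r v) * 2 ^ ∣ neighbours g v ∣ }) * q ^ (2 + n)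
      ≡⟨ cong (_* q ^ (2 + n)) (𝔼-indep (suc n) (λ r → 2^bit (lookup r v)) (λ g → 2 ^ ∣ neighbours g v ∣)) ⟩
    𝔼ʳ (suc n) (λ r → 2^bit (lookup r v)) * e * q ^ (2 + n)
      ≡⟨ cong (λ x → x * e * q ^ (2 + n)) (𝔼-2^bit n v) ⟩
    suc q * q ^ n * e * (q * q ^ suc n)
      ≡⟨ rearrange (suc q) (q ^ n) e q (q ^ suc n) ⟩
    suc q * q ^ suc n * (e * q ^ suc n)
      ≤⟨ *-monoʳ-≤ (suc q * q ^ suc n) (𝔼-2^degree v) ⟩
    suc q * q ^ suc n * (suc q ^ suc n * q ^ pairs (suc n))
      ≡⟨ [m*n]*[o*p]≡[m*o]*[n*p] (suc q) (q ^ suc n) (suc q ^ suc n) (q ^ pairs (suc n)) ⟩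
    suc q * suc q ^ suc n * (q ^ suc n * q ^ pairs (suc n))
      ≡⟨ cong (suc q ^ (2 + n) *_) (^-distribˡ-+-* q (suc n) (pairs (suc n))) ⟨
    suc q ^ (2 + n) * q ^ pairs (2 + n) ∎
    where
    open ≤-Reasoning
    e : ℕ
    e = 𝔼 (suc n) (λ g → 2 ^ ∣ neighbours g v ∣)
    rearrange : ∀ a b c d f → a * b * c * (d * f) ≡ a * (d * b) * (c * f)
    rearrange = solve-∀

  -- The first moment method

  countHom : ∀ {n} → Bool → ℕ → Graph n → ℕ
  countHom {n} c k g = sum (map (λ S → homogeneous c S g) (subsets n k))

  𝔼-countHom : ∀ n c k → 4 * n ^ k * weight c ^ pairs k ≤ q ^ pairs k →
    4 * 𝔼 n (countHom c k) ≤ q ^ pairs n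
  𝔼-countHom n c k small = *-cancelʳ-≤ _ _ (q ^ pairs k) {{m^n≢0 q (pairs k)}} (begin
    4 * 𝔼 n (countHom c k) * q ^ pairs k
      ≡⟨ *-assoc 4 (𝔼 n (countHom c k)) (q ^ pairs k) ⟩
    4 * (𝔼 n (countHom c k) * q ^ pairs k)
      ≤⟨ *-monoʳ-≤ 4 (𝔼-sum n (homogeneous c) (All.map (λ { {S} refl → ≤-reflexive (𝔼-homogeneous c S) }) (∣subsets∣ n k))) ⟩
    4 * (length (subsets n k) * (weight c ^ pairs k * q ^ pairs n))
      ≤⟨ *-monoʳ-≤ 4 (*-monoˡ-≤ (weight c ^ pairs k * q ^ pairs n) (length-subsets n k)) ⟩
    4 * (n ^ k * (weight c ^ pairs k * q ^ pairs n))
      ≡⟨ rearrange 4 (n ^ k) (weight c ^ pairs k) (q ^ pairs n) ⟩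
    4 * n ^ k * weight c ^ pairs k * q ^ pairs n
      ≤⟨ *-monoˡ-≤ (q ^ pairs n) small ⟩
    q ^ pairs k * q ^ pairs n
      ≡⟨ *-comm (q ^ pairs k) (q ^ pairs n) ⟩
    q ^ pairs n * q ^ pairs k ∎)
    where
    open ≤-Reasoning
    rearrange : ∀ a b c d → a * (b * (c * d)) ≡ a * b * c * d
    rearrange = solve-∀

  sum2^degree : ∀ {n} → Graph n → ℕ
  sum2^degree {n} g = sum (map (λ v → 2 ^ ∣ neighbours g v ∣) (allFin n))

  𝔼-sum2^degree : ∀ n Δ → 4 * n * suc q ^ n ≤ 2 ^ Δ * q ^ n →
    4 * 𝔼 n sum2^degree ≤ 2 ^ Δ * q ^ pairs n
  𝔼-sum2^degree n Δ small = *-cancelʳ-≤ _ _ (q ^ n) {{m^n≢0 q n}} (begin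
    4 * 𝔼 n sum2^degree * q ^ n
      ≡⟨ *-assoc 4 (𝔼 n sum2^degree) (q ^ n) ⟩
    4 * (𝔼 n sum2^degree * q ^ n)
      ≤⟨ *-monoʳ-≤ 4 (𝔼-sum n (λ v g → 2 ^ ∣ neighbours g v ∣) {xs = allFin n} (All.tabulate λ {v} _ → 𝔼-2^degree v)) ⟩
    4 * (length (allFin n) * (suc q ^ n * q ^ pairs n))
      ≡⟨ cong (λ l → 4 * (l * (suc q ^ n * q ^ pairs n))) (length-tabulate {n = n} (λ i → i)) ⟩
    4 * (n * (suc q ^ n * q ^ pairs n))
      ≡⟨ rearrange 4 n (suc q ^ n) (q ^ pairs n) ⟩
    4 * n * suc q ^ n * q ^ pairs n
      ≤⟨ *-monoˡ-≤ (q ^ pairs n) small ⟩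
    2 ^ Δ * q ^ n * q ^ pairs n
      ≡⟨ swap (2 ^ Δ) (q ^ n) (q ^ pairs n) ⟩
    2 ^ Δ * q ^ pairs n * q ^ n ∎)
    where
    open ≤-Reasoning
    rearrange : ∀ a b c d → a * (b * (c * d)) ≡ a * b * c * d
    rearrange = solve-∀
    swap : ∀ a b c → a * b * c ≡ a * c * b
    swap = solve-∀

  -- Each hypothesis pays for one kind of failure with a quarter of `2 ^ Δ`. The mean of `X` is then
  -- at most three quarters of `2 ^ Δ`, and a graph that does not exceed the mean satisfies all
  -- requirements at once.
  sparse-exists : ∀ n k t Δ →
    4 * n ^ k * p ^ pairs k ≤ q ^ pairs k →
    4 * n ^ t ≤ q ^ pairs t →
    4 * n * suc q ^ n ≤ 2 ^ Δ * q ^ n →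
    ∃ λ (g : Graph n) → Sparse k t Δ g
  sparse-exists n k t Δ hk ht hΔ with 𝔼-attained n X
    where
    -- At least 2 ^ Δ as soon as one of the three requirements fails; the
    -- exponential moment of the degrees replaces a Chernoff bound.
    X : Graph n → ℕ
    X g = 2 ^ Δ * (countHom false k g + countHom true t g) + sum2^degree g
  ... | g , attained = g , record
    { noIndependent = λ { S refl → n<1⇒n≡0 (≤-<-trans (≤-trans (∈⇒≤sum (λ S → homogeneous false S g) (∈-subsets S)) (m≤m+n _ _)) none) }
    ; noClique      = λ { S refl → n<1⇒n≡0 (≤-<-trans (≤-trans (∈⇒≤sum (λ S → homogeneous true S g) (∈-subsets S)) (m≤n+m _ (countHom false k g))) none) }
    ; maxDegree     = λ v → ≰⇒> λ Δ≤ → <⇒≱ X<2^Δ (≤-trans (^-monoʳ-≤ 2 Δ≤)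
        (≤-trans (∈⇒≤sum (λ v → 2 ^ ∣ neighbours g v ∣) (∈-allFin v)) (m≤n+m _ _)))
    }
    where
    open ≤-Reasoning
    Q I C D x : ℕ
    Q = q ^ pairs n
    I = 𝔼 n (countHom false k)
    C = 𝔼 n (countHom true t)
    D = 𝔼 n sum2^degree
    x = 2 ^ Δ * (countHom false k g + countHom true t g) + sum2^degree g
    four : 4 * (Q * x) < 4 * (Q * 2 ^ Δ)
    four = begin-strict
      4 * (Q * x)
        ≤⟨ *-monoʳ-≤ 4 attained ⟩
      4 * 𝔼 n (λ g → 2 ^ Δ * (countHom false k g + countHom true t g) + sum2^degree g)
        ≡⟨ cong (4 *_) (trans (𝔼-+ n _ sum2^degree) (cong (_+ D) (trans (𝔼-*ˡ n (2 ^ Δ) _)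
             (cong (2 ^ Δ *_) (𝔼-+ n (countHom false k) (countHom true t)))))) ⟩
      4 * (2 ^ Δ * (I + C) + D)
        ≡⟨ rearrange (2 ^ Δ) I C D ⟩
      2 ^ Δ * (4 * I) + 2 ^ Δ * (4 * C) + 4 * D
        ≤⟨ +-mono-≤ (+-mono-≤ (*-monoʳ-≤ (2 ^ Δ) (𝔼-countHom n false k hk))
                              (*-monoʳ-≤ (2 ^ Δ) (𝔼-countHom n true t ht′))) (𝔼-sum2^degree n Δ hΔ) ⟩
      2 ^ Δ * Q + 2 ^ Δ * Q + 2 ^ Δ * Q
        <⟨ m<m+n _ {2 ^ Δ * Q} (*-mono-≤ (m^n>0 2 Δ) (m^n>0 q (pairs n))) ⟩
      2 ^ Δ * Q + 2 ^ Δ * Q + 2 ^ Δ * Q + 2 ^ Δ * Q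
        ≡⟨ collect (2 ^ Δ) Q ⟩
      4 * (Q * 2 ^ Δ) ∎
      where
      ht′ : 4 * n ^ t * 1 ^ pairs t ≤ q ^ pairs t
      ht′ = ≤-trans (≤-reflexive (trans (cong (4 * n ^ t *_) (^-zeroˡ (pairs t))) (*-identityʳ _))) ht
      rearrange : ∀ T I C D → 4 * (T * (I + C) + D) ≡ T * (4 * I) + T * (4 * C) + 4 * D
      rearrange = solve-∀
      collect : ∀ T Q → T * Q + T * Q + T * Q + T * Q ≡ 4 * (Q * T)
      collect = solve-∀
    X<2^Δ : x < 2 ^ Δ
    X<2^Δ = *-cancelˡ-< Q x (2 ^ Δ) (*-cancelˡ-< 4 (Q * x) (Q * 2 ^ Δ) four)
    none : countHom false k g + countHom true t g < 1
    none = *-cancelˡ-< (2 ^ Δ) _ 1 (≤-<-trans (m≤m+n _ (sum2^degree g)) (≤-trans X<2^Δ (≤-reflexive (sym (*-identityʳ (2 ^ Δ))))))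

-- Existence of Ramsey numbers

∈-image⁺ : ∀ {n N} (f : Fin n → Fin N) {e x} → x ∈ e → f x ∈ image f e
∈-image⁺ f {e} {x} x∈ = lookup⇒[]= (f x) (image f e)
  (trans (lookup∘tabulate _ (f x)) (dec-true (any? λ z → (z ∈? e) ×-dec (f z ≟ᶠ f x)) (x , x∈ , refl)))

∈-image⁻ : ∀ {n N} (f : Fin n → Fin N) {e y} → y ∈ image f e → ∃ λ x → x ∈ e × f x ≡ y
∈-image⁻ f {e} {y} y∈ with any? (λ z → (z ∈? e) ×-dec (f z ≟ᶠ y)) | trans (sym (lookup∘tabulate (λ y → does (any? λ z → (z ∈? e) ×-dec (f z ≟ᶠ y))) y)) ([]=⇒lookup y∈)
... | yes found | _ = found
... | no  _     | ()

image-cong : ∀ {n N} {f g : Fin n → Fin N} → f ≗ g → ∀ e → image f e ≡ image g e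
image-cong {f = f} {g} f≗g e = ⊆-antisym (sub f g f≗g) (sub g f (sym ∘ f≗g))
  where
  sub : ∀ f g → f ≗ g → ∀ {y} → y ∈ image f e → y ∈ image g e
  sub f g f≗g y∈ with ∈-image⁻ f y∈
  ... | x , x∈ , refl = subst (_∈ image g e) (sym (f≗g x)) (∈-image⁺ g x∈)

-- Ramsey's theorem for colourings of sublists

Monochromatic : ∀ {A : Set} → Colour → ℕ → (List A → Colour) → List A → Set
Monochromatic k s c L = ∀ {xs} → xs ⊑ L → length xs ≡ s → c xs ≡ k

MonochromaticSublist : ∀ {A : Set} → Colour → ℕ → (List A → Colour) → List A → ℕ → Set
MonochromaticSublist k s c L m = ∃ λ L′ → L′ ⊑ L × length L′ ≡ m × Monochromatic k s c L′

mono-⊑ : ∀ {A : Set} {k s c m} {L L′ : List A} → L ⊑ L′ → MonochromaticSublist k s c L m → MonochromaticSublist k s c L′ m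
mono-⊑ τ (M , σ , len , mono) = M , ⊆-trans σ τ , len , mono

-- A sublist that starts with `x` is coloured through the link of `x`, which is monochromatic on all
-- of `M`; any other sublist already lies in the smaller list.
mono-∷ : ∀ {A : Set} {k s c m x} {L M : List A} → M ⊑ L → Monochromatic k s (c ∘ (x ∷_)) M →
  MonochromaticSublist k (suc s) c M m → MonochromaticSublist k (suc s) c (x ∷ L) (suc m)
mono-∷ {k = k} {s} {c} {x = x} τ link (M′ , σ , len , mono) = x ∷ M′ , refl ∷ ⊆-trans σ τ , cong suc len , mono′
  where
  mono′ : Monochromatic k (suc s) c (x ∷ M′)
  mono′ (_ ∷ʳ ρ)   l = mono ρ l
  mono′ (refl ∷ ρ) l = link (⊆-trans ρ σ) (suc-injective l)

mono-[] : ∀ {A : Set} {k s c} {L : List A} → MonochromaticSublist k (suc s) c L 0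
mono-[] {L = L} = [] , minimum L , refl , λ { [] () }

-- The Erdős-Szekeres recursion. The link of the first element `x` is a colouring of lists one
-- shorter, so by induction on `s` it is monochromatic on a long sublist `M`. Within `M` either the
-- other colour already succeeds, or a list one short in the colour of the link is found and `x`
-- completes it. Sublists present every set in one fixed order, so a colouring of lists need not be
-- symmetric.
ramsey : ∀ s m n → ∃ λ N → ∀ {A : Set} (c : List A → Colour) L → N ≤ length L →
  MonochromaticSublist blue s c L m ⊎ MonochromaticSublist red s c L n
ramsey zero m n = m + n , go
  where
  constant : ∀ {A : Set} {k} {c : List A → Colour} → c [] ≡ k → ∀ l L → l ≤ length L → MonochromaticSublist k 0 c L l
  constant ck l L l≤ = take l L , take-⊆ l L , trans (length-take l L) (m≤n⇒m⊓n≡m l≤) , λ { {[]} _ _ → ck }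
  go : ∀ {A : Set} (c : List A → Colour) L → m + n ≤ length L →
    MonochromaticSublist blue 0 c L m ⊎ MonochromaticSublist red 0 c L n
  go c L long with c [] in eq
  ... | blue = inj₁ (constant eq m L (≤-trans (m≤m+n m n) long))
  ... | red  = inj₂ (constant eq n L (≤-trans (m≤n+m n m) long))
ramsey (suc s) zero    n       = 0 , λ _ _ _ → inj₁ mono-[]
ramsey (suc s) (suc m) zero    = 0 , λ _ _ _ → inj₂ mono-[]
ramsey (suc s) (suc m) (suc n)
  with ramsey (suc s) m (suc n) | ramsey (suc s) (suc m) n
... | N₁ , r₁ | N₂ , r₂ with ramsey s N₁ N₂
... | N , r = suc N , go
  where
  go : ∀ {A : Set} (c : List A → Colour) L → suc N ≤ length L →
    MonochromaticSublist blue (suc s) c L (suc m) ⊎ MonochromaticSublist red (suc s) c L (suc n)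
  go c (x ∷ L) (s≤s long) with r (c ∘ (x ∷_)) L long
  ... | inj₁ (M , τ , len , link) = Sum.map (mono-∷ τ link) (mono-⊑ (x ∷ʳ τ)) (r₁ c M (≤-reflexive (sym len)))
  ... | inj₂ (M , τ , len , link) = Sum.map (mono-⊑ (x ∷ʳ τ)) (mono-∷ τ link) (r₂ c M (≤-reflexive (sym len)))

-- From monochromatic lists to copies of 3-graphs

elements : ∀ {n} → Subset n → List (Fin n)
elements []          = []
elements (true  ∷ e) = zero ∷ map suc (elements e)
elements (false ∷ e) = map suc (elements e)

length-elements : ∀ {n} (e : Subset n) → length (elements e) ≡ ∣ e ∣
length-elements []          = refl
length-elements (true  ∷ e) = cong suc (trans (length-map suc (elements e)) (length-elements e))
length-elements (false ∷ e) = trans (length-map suc (elements e)) (length-elements e)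

∈-elements⁺ : ∀ {n} {e : Subset n} {x} → x ∈ e → x ∈ˡ elements e
∈-elements⁺ here = here refl
∈-elements⁺ {e = true  ∷ e} (there x∈) = there (∈-map⁺ suc (∈-elements⁺ x∈))
∈-elements⁺ {e = false ∷ e} (there x∈) = ∈-map⁺ suc (∈-elements⁺ x∈)

∈-elements⁻ : ∀ {n} (e : Subset n) {x} → x ∈ˡ elements e → x ∈ e
∈-elements⁻ (true  ∷ e) (here refl) = here
∈-elements⁻ (true  ∷ e) (there x∈) with ∈-map⁻ suc x∈
... | y , y∈ , refl = there (∈-elements⁻ e y∈)
∈-elements⁻ (false ∷ e) x∈ with ∈-map⁻ suc x∈
... | y , y∈ , refl = there (∈-elements⁻ e y∈)

elements-⊑ : ∀ {n} (e : Subset n) → elements e ⊑ allFin n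
elements-⊑ []          = []
elements-⊑ {suc n} (true  ∷ e) = refl ∷ ⊆-trans (map⁺ suc (elements-⊑ e)) (⊆-reflexive (map-tabulate id suc))
elements-⊑ {suc n} (false ∷ e) = zero ∷ʳ ⊆-trans (map⁺ suc (elements-⊑ e)) (⊆-reflexive (map-tabulate id suc))

fromElements : ∀ {N} → List (Fin N) → Subset N
fromElements = foldr (λ x S → ⁅ x ⁆ ∪ S) ⊥

∈-fromElements⁺ : ∀ {N} {L : List (Fin N)} {x} → x ∈ˡ L → x ∈ fromElements L
∈-fromElements⁺ (here refl) = x∈p∪q⁺ (inj₁ (x∈⁅x⁆ _))
∈-fromElements⁺ (there x∈)  = x∈p∪q⁺ (inj₂ (∈-fromElements⁺ x∈))

∈-fromElements⁻ : ∀ {N} (L : List (Fin N)) {x} → x ∈ fromElements L → x ∈ˡ L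
∈-fromElements⁻ []      x∈ = contradiction x∈ ∉⊥
∈-fromElements⁻ (y ∷ L) x∈ with x∈p∪q⁻ ⁅ y ⁆ (fromElements L) x∈
... | inj₁ x∈y = here (x∈⁅y⁆⇒x≡y y x∈y)
... | inj₂ x∈L = there (∈-fromElements⁻ L x∈L)

image≡fromElements : ∀ {n N} (f : Fin n → Fin N) e → image f e ≡ fromElements (map f (elements e))
image≡fromElements f e = ⊆-antisym to from
  where
  to : ∀ {y} → y ∈ image f e → y ∈ fromElements (map f (elements e))
  to y∈ with ∈-image⁻ f y∈
  ... | x , x∈ , refl = ∈-fromElements⁺ (∈-map⁺ f (∈-elements⁺ x∈))
  from : ∀ {y} → y ∈ fromElements (map f (elements e)) → y ∈ image f e
  from y∈ with ∈-map⁻ f (∈-fromElements⁻ (map f (elements e)) y∈)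
  ... | x , x∈ , refl = ∈-image⁺ f (∈-elements⁻ e x∈)

Unique-resp-⊑ : ∀ {A : Set} {L M : List A} → L ⊑ M → Unique M → Unique L
Unique-resp-⊑ []         []       = []
Unique-resp-⊑ (_ ∷ʳ τ)   (_ ∷ u)  = Unique-resp-⊑ τ u
Unique-resp-⊑ (refl ∷ τ) (x∉ ∷ u) = All-resp-⊆ τ x∉ ∷ Unique-resp-⊑ τ u

lookupˡ-injective : ∀ {A : Set} {L : List A} → Unique L → Injective _≡_ _≡_ (lookupˡ L)
lookupˡ-injective (x∉ ∷ u) {zero}  {zero}  _  = refl
lookupˡ-injective (x∉ ∷ u) {zero}  {suc j} eq = contradiction eq (All.lookup x∉ (∈-lookup j))
lookupˡ-injective (x∉ ∷ u) {suc i} {zero}  eq = contradiction (sym eq) (All.lookup x∉ (∈-lookup i))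
lookupˡ-injective (x∉ ∷ u) {suc i} {suc j} eq = cong suc (lookupˡ-injective u eq)

-- The list itself serves as the embedding. Since `elements e` is increasing, its image under
-- `lookupˡ L` is a sublist of `L`, and it has length 3.
monochromatic⇒copy : ∀ {n N k} {χ : Colouring N} (H : ThreeGraph n) →
  MonochromaticSublist k 3 (χ ∘ fromElements) (allFin N) n → Copy k χ H
monochromatic⇒copy {N = N} {k} {χ} H (L , τ , refl , mono) =
  lookupˡ L , lookupˡ-injective (Unique-resp-⊑ τ (Unique.allFin⁺ N)) , All.map coloured (uniform H)
  where
  coloured : ∀ {e} → ∣ e ∣ ≡ 3 → χ (image (lookupˡ L) e) ≡ k
  coloured {e} ∣e∣≡3 = trans (cong χ (image≡fromElements (lookupˡ L) e))
    (mono (⊆-trans (map⁺ (lookupˡ L) (elements-⊑ e)) (⊆-reflexive (trans (map-tabulate id (lookupˡ L)) (tabulate-lookup L))))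
          (trans (length-map (lookupˡ L) (elements e)) (trans (length-elements e) ∣e∣≡3)))

arrows-exists : ∀ {m n} (G : ThreeGraph m) (H : ThreeGraph n) → ∃ λ N → Arrows N G H
arrows-exists {m} {n} G H with ramsey 3 m n
... | N , r = N , λ χ → Sum.map (monochromatic⇒copy {χ = χ} G) (monochromatic⇒copy {χ = χ} H)
  (r (χ ∘ fromElements) (allFin N) (≤-reflexive (sym (length-tabulate {n = N} id))))

-- Decidability of the arrow relation

allColourings? : ∀ N {P : Colouring N → Set} → (∀ {χ χ′} → χ ≗ χ′ → P χ → P χ′) →
  (∀ χ → Dec (P χ)) → Dec (∀ χ → P χ)
allColourings? zero {P} resp P? = map′ to (λ h → h (λ _ → red) , h (λ _ → blue)) (P? (λ _ → red) ×-dec P? (λ _ → blue))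
  where
  to : P (λ _ → red) × P (λ _ → blue) → ∀ χ → P χ
  to (r , b) χ with χ [] in eq
  ... | red  = resp (λ { [] → sym eq }) r
  ... | blue = resp (λ { [] → sym eq }) b
-- A colouring is a pair of colourings on one point fewer, for the sets with and without `zero`.
-- Without function extensionality the pair is only pointwise equal to the given colouring, hence
-- the hypothesis `resp`.
allColourings? (suc N) {P} resp P? = map′ (λ h χ → resp (η χ) (h (χ ∘ (true ∷_)) (χ ∘ (false ∷_)))) (λ h χ₁ χ₀ → h (join χ₁ χ₀))
  (allColourings? N (λ e h χ₀ → resp (join-cong e λ _ → refl) (h χ₀)) λ χ₁ →
   allColourings? N (λ e → resp (join-cong (λ _ → refl) e)) λ χ₀ → P? (join χ₁ χ₀))
  where
  join : Colouring N → Colouring N → Colouring (suc N)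
  join χ₁ χ₀ (true  ∷ e) = χ₁ e
  join χ₁ χ₀ (false ∷ e) = χ₀ e
  join-cong : ∀ {χ₁ χ₁′ χ₀ χ₀′} → χ₁ ≗ χ₁′ → χ₀ ≗ χ₀′ → join χ₁ χ₀ ≗ join χ₁′ χ₀′
  join-cong e₁ e₀ (true  ∷ e) = e₁ e
  join-cong e₁ e₀ (false ∷ e) = e₀ e
  η : ∀ χ → join (χ ∘ (true ∷_)) (χ ∘ (false ∷_)) ≗ χ
  η χ (true  ∷ e) = refl
  η χ (false ∷ e) = refl

anyFunction? : ∀ n {N} {P : (Fin n → Fin N) → Set} → (∀ {f g} → f ≗ g → P f → P g) →
  (∀ f → Dec (P f)) → Dec (∃ P)
anyFunction? zero {N} resp P? = map′ (none ,_) (λ { (f , pf) → resp (λ ()) pf }) (P? none)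
  where
  none : Fin 0 → Fin N
  none ()
anyFunction? (suc n) resp P? = map′ (λ { (x , f , pf) → x ∷ᶠ f , pf })
  (λ { (f , pf) → f zero , f ∘ suc , resp (λ { zero → refl ; (suc i) → refl }) pf })
  (any? λ x → anyFunction? n (λ e → resp λ { zero → refl ; (suc i) → e i }) λ f → P? (x ∷ᶠ f))

_≟ᶜ_ : (k l : Colour) → Dec (k ≡ l)
red  ≟ᶜ red  = yes refl
red  ≟ᶜ blue = no λ ()
blue ≟ᶜ red  = no λ ()
blue ≟ᶜ blue = yes refl

copy? : ∀ {n N} k (χ : Colouring N) (G : ThreeGraph n) → Dec (Copy k χ G)
copy? {n} k χ G = anyFunction? n
  (λ { f≗g (inj , all) → (λ {x} {y} eq → inj (trans (f≗g x) (trans eq (sym (f≗g y)))))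
                       , All.map (λ {e} → trans (cong χ (sym (image-cong f≗g e)))) all })
  λ f → map′ (λ h {x} {y} → h x y) (λ h x y → h {x} {y}) (all? λ x → all? λ y → (f x ≟ᶠ f y) →-dec (x ≟ᶠ y))
        ×-dec All.all? (λ e → χ (image f e) ≟ᶜ k) (edges G)

copy-resp : ∀ {n N k} {χ χ′ : Colouring N} (G : ThreeGraph n) → χ ≗ χ′ → Copy k χ G → Copy k χ′ G
copy-resp G χ≗χ′ (f , inj , all) = f , inj , All.map (λ {e} → trans (sym (χ≗χ′ (image f e)))) all

arrows? : ∀ {m n} N (G : ThreeGraph m) (H : ThreeGraph n) → Dec (Arrows N G H)
arrows? N G H = allColourings? N (λ e → Sum.map (copy-resp G e) (copy-resp H e)) λ χ → copy? blue χ G ⊎-dec copy? red χ H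

least : ∀ {P : ℕ → Set} → (∀ n → Dec (P n)) → ∀ N → P N → ∃ λ R → P R × (∀ M → P M → R ≤ M)
least P? zero    p = 0 , p , λ _ _ → z≤n
least P? (suc N) p with P? 0
... | yes p₀ = 0 , p₀ , λ _ _ → z≤n
... | no ¬p₀ with least (P? ∘ suc) N p
...   | R , pR , min = suc R , pR , λ { zero p₀ → contradiction p₀ ¬p₀ ; (suc M) pM → s≤s (min M pM) }

ramseyNumber : ∀ {m n} (G : ThreeGraph m) (H : ThreeGraph n) → ∃ (IsRamseyNumber G H)
ramseyNumber G H with arrows-exists G H
... | N , arrows = least (λ N → arrows? N G H) N arrows

-- Hedgehogs

∣⁅x⁆∪p∣ : ∀ {n} {x : Fin n} {p} → x ∉ p → ∣ ⁅ x ⁆ ∪ p ∣ ≡ suc ∣ p ∣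
∣⁅x⁆∪p∣ {x = zero}  {true  ∷ p} x∉ = contradiction here x∉
∣⁅x⁆∪p∣ {x = zero}  {false ∷ p} x∉ = cong (suc ∘ ∣_∣) (∪-identityˡ p)
∣⁅x⁆∪p∣ {x = suc x} {true  ∷ p} x∉ = cong suc (∣⁅x⁆∪p∣ (x∉ ∘ there))
∣⁅x⁆∪p∣ {x = suc x} {false ∷ p} x∉ = ∣⁅x⁆∪p∣ (x∉ ∘ there)

∣p∪q∣≤∣p∣+∣q∣ : ∀ {n} (p q : Subset n) → ∣ p ∪ q ∣ ≤ ∣ p ∣ + ∣ q ∣
∣p∪q∣≤∣p∣+∣q∣ []          []          = z≤n
∣p∪q∣≤∣p∣+∣q∣ (true  ∷ p) (true  ∷ q) = s≤s (≤-trans (∣p∪q∣≤∣p∣+∣q∣ p q) (+-monoʳ-≤ ∣ p ∣ (n≤1+n ∣ q ∣)))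
∣p∪q∣≤∣p∣+∣q∣ (true  ∷ p) (false ∷ q) = s≤s (∣p∪q∣≤∣p∣+∣q∣ p q)
∣p∪q∣≤∣p∣+∣q∣ (false ∷ p) (true  ∷ q) = ≤-trans (s≤s (∣p∪q∣≤∣p∣+∣q∣ p q)) (≤-reflexive (sym (+-suc ∣ p ∣ ∣ q ∣)))
∣p∪q∣≤∣p∣+∣q∣ (false ∷ p) (false ∷ q) = ∣p∪q∣≤∣p∣+∣q∣ p q

∣p++q∣ : ∀ {m n} (p : Subset m) (q : Subset n) → ∣ p ++ q ∣ ≡ ∣ p ∣ + ∣ q ∣
∣p++q∣ []          q = refl
∣p++q∣ (true  ∷ p) q = cong suc (∣p++q∣ p q)
∣p++q∣ (false ∷ p) q = ∣p++q∣ p q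

∈-++ˡ⁺ : ∀ {m n} {p : Subset m} {q : Subset n} {x} → x ∈ p → x ↑ˡ n ∈ p ++ q
∈-++ˡ⁺ here       = here
∈-++ˡ⁺ (there x∈) = there (∈-++ˡ⁺ x∈)

∈-++ˡ⁻ : ∀ {m n} (p : Subset m) {q : Subset n} {x} → x ↑ˡ n ∈ p ++ q → x ∈ p
∈-++ˡ⁻ (_ ∷ p) {x = zero}  here       = here
∈-++ˡ⁻ (_ ∷ p) {x = suc x} (there x∈) = there (∈-++ˡ⁻ p x∈)

∈-++ʳ⁺ : ∀ {m n} (p : Subset m) {q : Subset n} {y} → y ∈ q → m ↑ʳ y ∈ p ++ q
∈-++ʳ⁺ []      y∈ = y∈
∈-++ʳ⁺ (_ ∷ p) y∈ = there (∈-++ʳ⁺ p y∈)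

∈-++ʳ⁻ : ∀ {m n} (p : Subset m) {q : Subset n} {y} → m ↑ʳ y ∈ p ++ q → y ∈ q
∈-++ʳ⁻ []      y∈         = y∈
∈-++ʳ⁻ (_ ∷ p) (there y∈) = ∈-++ʳ⁻ p y∈

∣fromElements∣ : ∀ {N} {L : List (Fin N)} → Unique L → ∣ fromElements L ∣ ≡ length L
∣fromElements∣ {N} [] = ∣⊥∣≡0 N
∣fromElements∣ {L = x ∷ L} (x∉ ∷ u) =
  trans (∣⁅x⁆∪p∣ λ x∈ → All.lookup x∉ (∈-fromElements⁻ L x∈) refl) (cong suc (∣fromElements∣ u))

range : ∀ {n N} → (Fin n → Fin N) → Subset N
range f = fromElements (tabulate f)

∣range∣ : ∀ {n N} {f : Fin n → Fin N} → Injective _≡_ _≡_ f → ∣ range f ∣ ≡ n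
∣range∣ {f = f} inj = trans (∣fromElements∣ (Unique.tabulate⁺ inj)) (length-tabulate f)

∈-range⁻ : ∀ {n N} (f : Fin n → Fin N) {y} → y ∈ range f → ∃ λ x → y ≡ f x
∈-range⁻ f y∈ = ∈-tabulate⁻ (∈-fromElements⁻ (tabulate f) y∈)

unique-constant : ∀ {A : Set} {a : A} {xs} → Unique xs → (∀ {x} → x ∈ˡ xs → x ≡ a) → length xs ≤ 1
unique-constant {xs = []}         _ _ = z≤n
unique-constant {xs = _ ∷ []}     _ _ = s≤s z≤n
unique-constant {xs = _ ∷ _ ∷ _} ((x≢y ∷ _) ∷ _) eq = contradiction (trans (eq (here refl)) (sym (eq (there (here refl))))) x≢y

data Split m {n} : Fin (m + n) → Set where
  left  : (i : Fin m) → Split m (i ↑ˡ n)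
  right : (j : Fin n) → Split m (m ↑ʳ j)

split : ∀ m {n} (v : Fin (m + n)) → Split m v
split m {n} v with splitAt m v in eq
... | inj₁ i = subst (Split m) (splitAt⁻¹-↑ˡ eq) (left i)
... | inj₂ j = subst (Split m) (splitAt⁻¹-↑ʳ eq) (right j)

-- Body vertices come first, as `i ↑ˡ m`, and spikes last, as `k ↑ʳ s`. The spike determines the
-- edge, so the edges are distinct even where `att` repeats a pair.
module Hedgehog {k m : ℕ} (att : Fin m → Fin k × Fin k) (att≢ : ∀ s → proj₁ (att s) ≢ proj₂ (att s)) where

  base : Fin m → Subset k
  base s = ⁅ proj₁ (att s) ⁆ ∪ ⁅ proj₂ (att s) ⁆

  edge : Fin m → Subset (k + m)
  edge s = base s ++ ⁅ s ⁆

  ∣base∣ : ∀ s → ∣ base s ∣ ≡ 2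
  ∣base∣ s = trans (∣⁅x⁆∪p∣ (x≢y⇒x∉⁅y⁆ (att≢ s))) (cong suc (∣⁅x⁆∣≡1 (proj₂ (att s))))

  ∣edge∣ : ∀ s → ∣ edge s ∣ ≡ 3
  ∣edge∣ s = trans (∣p++q∣ (base s) ⁅ s ⁆) (cong₂ _+_ (∣base∣ s) (∣⁅x⁆∣≡1 s))

  body₁∈edge : ∀ s → proj₁ (att s) ↑ˡ m ∈ edge s
  body₁∈edge s = ∈-++ˡ⁺ {p = base s} (x∈p∪q⁺ (inj₁ (x∈⁅x⁆ (proj₁ (att s)))))

  body₂∈edge : ∀ s → proj₂ (att s) ↑ˡ m ∈ edge s
  body₂∈edge s = ∈-++ˡ⁺ {p = base s} (x∈p∪q⁺ {p = ⁅ proj₁ (att s) ⁆} (inj₂ (x∈⁅x⁆ (proj₂ (att s)))))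

  spike∈edge : ∀ s → k ↑ʳ s ∈ edge s
  spike∈edge s = ∈-++ʳ⁺ (base s) (x∈⁅x⁆ s)

  spike∈edge⁻ : ∀ {s s′} → k ↑ʳ s ∈ edge s′ → s ≡ s′
  spike∈edge⁻ {s′ = s′} s∈ = x∈⁅y⁆⇒x≡y s′ (∈-++ʳ⁻ (base s′) s∈)

  ∈-edge⁻ : ∀ {s v} → v ∈ edge s → v ≡ proj₁ (att s) ↑ˡ m ⊎ v ≡ proj₂ (att s) ↑ˡ m ⊎ v ≡ k ↑ʳ s
  ∈-edge⁻ {s} {v} v∈ with split k v
  ... | right s′ = inj₂ (inj₂ (cong (k ↑ʳ_) (spike∈edge⁻ v∈)))
  ... | left i with x∈p∪q⁻ ⁅ proj₁ (att s) ⁆ ⁅ proj₂ (att s) ⁆ (∈-++ˡ⁻ (base s) v∈)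
  ...   | inj₁ i∈ = inj₁ (cong (_↑ˡ m) (x∈⁅y⁆⇒x≡y _ i∈))
  ...   | inj₂ i∈ = inj₂ (inj₁ (cong (_↑ˡ m) (x∈⁅y⁆⇒x≡y _ i∈)))

  hedgehog : ThreeGraph (k + m)
  hedgehog = record
    { edges   = tabulate edge
    ; unique  = Unique.tabulate⁺ λ {s} {s′} eq → spike∈edge⁻ (subst (k ↑ʳ s ∈_) eq (spike∈edge s))
    ; uniform = All.tabulate⁺ ∣edge∣
    }

  edge-at-spike : ∀ {e s} → e ∈ˡ edges hedgehog → k ↑ʳ s ∈ e → e ≡ edge s
  edge-at-spike {s = s} e∈ s∈ with ∈-tabulate⁻ e∈
  ... | s′ , refl = cong edge (sym (spike∈edge⁻ s∈))

  isHedgehog : IsGeneralisedHedgehog hedgehog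
  isHedgehog = record
    { body      = ⊤ {k} ++ ⊥ {m}
    ; edgeShape = All.tabulate⁺ λ s → spikeShape s , bodyShape s
    ; spikeOnce = once
    }
    where
    bodyShape : ∀ s → ∣ edge s ∩ (⊤ {k} ++ ⊥ {m}) ∣ ≡ 2
    bodyShape s = trans (cong ∣_∣ (zipWith-++ _∧_ (base s) ⁅ s ⁆ ⊤ ⊥)) (trans (∣p++q∣ (base s ∩ ⊤) (⁅ s ⁆ ∩ ⊥))
      (cong₂ _+_ (trans (cong ∣_∣ (∩-identityʳ (base s))) (∣base∣ s)) (trans (cong ∣_∣ (∩-zeroʳ ⁅ s ⁆)) (∣⊥∣≡0 m))))
    ∁body : ∁ (⊤ {k} ++ ⊥ {m}) ≡ ⊥ {k} ++ ⊤ {m}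
    ∁body = trans (map-++ not (⊤ {k}) (⊥ {m})) (cong₂ _++_ (map-replicate not true k) (map-replicate not false m))
    spikeShape : ∀ s → ∣ edge s ∩ ∁ (⊤ {k} ++ ⊥ {m}) ∣ ≡ 1
    spikeShape s = trans (cong (λ b → ∣ edge s ∩ b ∣) ∁body)
      (trans (cong ∣_∣ (zipWith-++ _∧_ (base s) ⁅ s ⁆ ⊥ ⊤)) (trans (∣p++q∣ (base s ∩ ⊥) (⁅ s ⁆ ∩ ⊤))
      (cong₂ _+_ (trans (cong ∣_∣ (∩-zeroʳ (base s))) (∣⊥∣≡0 k)) (trans (cong ∣_∣ (∩-identityʳ ⁅ s ⁆)) (∣⁅x⁆∣≡1 s)))))
    once : ∀ v → v ∉ ⊤ {k} ++ ⊥ {m} → degree (edges hedgehog) v ≡ 1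
    once v v∉ with split k v
    ... | left i  = contradiction (∈-++ˡ⁺ ∈⊤) v∉
    ... | right s = ≤-antisym
      (unique-constant (Unique.filter⁺ (k ↑ʳ s ∈?_) (unique hedgehog)) λ e∈ →
        let e∈H , s∈e = ∈-filter⁻ (k ↑ʳ s ∈?_) {xs = edges hedgehog} e∈ in edge-at-spike e∈H s∈e)
      (∈-length (∈-filter⁺ (k ↑ʳ s ∈?_) (∈-tabulate⁺ s) (spike∈edge s)))

  -- A spike lies in at most one edge. If the subhypergraph has no spike among its vertices, it has
  -- no edges, and any of its vertices has degree 0.
  degenerate : Degenerate 1 hedgehog
  degenerate K (v , v∈K) with any? (λ s → k ↑ʳ s ∈? vertices K)
  ... | yes (s , s∈K) = k ↑ʳ s , s∈K ,
    unique-constant (Unique.filter⁺ (k ↑ʳ s ∈?_) (subUnique K)) λ e∈ →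
      let e∈K , s∈e = ∈-filter⁻ (k ↑ʳ s ∈?_) {xs = subEdges K} e∈ in edge-at-spike (fromG K e∈K) s∈e
  ... | no noSpike = v , v∈K , ≤-trans (≤-reflexive (cong length (filter-none (v ∈?_) (All.tabulate λ e∈K _ → noEdge e∈K)))) z≤n
    where
    noEdge : ∀ {e} → ¬ e ∈ˡ subEdges K
    noEdge e∈K with ∈-tabulate⁻ (fromG K e∈K)
    ... | s , refl = noSpike (s , All.lookup (within K) e∈K (spike∈edge s))

-- The colouring given by a sparse graph

∉neighbours : ∀ {N} (g : Graph N) x → x ∉ neighbours g x
∉neighbours (r , g) (suc x) (there x∈) = ∉neighbours g x x∈

ContainsEdge : ∀ {N} → Graph N → Subset N → Set
ContainsEdge g e = ∃ λ x → ∃ λ y → x ∈ e × y ∈ e × y ∈ neighbours g x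

containsEdge? : ∀ {N} (g : Graph N) e → Dec (ContainsEdge g e)
containsEdge? g e = any? λ x → any? λ y → (x ∈? e) ×-dec ((y ∈? e) ×-dec (y ∈? neighbours g x))

colouring : ∀ {N} → Graph N → Colouring N
colouring g e = if does (containsEdge? g e) then red else blue

colouring-red : ∀ {N} (g : Graph N) {e} → colouring g e ≡ red → ContainsEdge g e
colouring-red g {e} eq with containsEdge? g e
... | yes found = found
colouring-red g {e} () | no _

colouring-blue : ∀ {N} (g : Graph N) {e} → colouring g e ≡ blue → ¬ ContainsEdge g e
colouring-blue g {e} eq with containsEdge? g e
colouring-blue g {e} () | yes _
... | no none = none

range-homogeneous : ∀ {n N} c (g : Graph N) (f : Fin n → Fin N) →
  (∀ i j → i ≢ j → lookup (neighbours g (f i)) (f j) ≡ c) → homogeneous c (range f) g ≡ 1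
range-homogeneous c g f h = homogeneous≡1 c (range f) g pairwise
  where
  pairwise : ∀ {x y} → x ∈ range f → y ∈ range f → x ≢ y → lookup (neighbours g x) y ≡ c
  pairwise x∈ y∈ x≢y with ∈-range⁻ f x∈ | ∈-range⁻ f y∈
  ... | i , refl | j , refl = h i j λ { refl → x≢y refl }

∉⇒lookup≡false : ∀ {n} {p : Subset n} {x} → x ∉ p → lookup p x ≡ false
∉⇒lookup≡false {p = p} {x} x∉ with lookup p x in eq
... | true  = contradiction (lookup⇒[]= x p eq) x∉
... | false = refl

module _ {k m : ℕ} (att : Fin m → Fin k × Fin k) (att≢ : ∀ s → proj₁ (att s) ≢ proj₂ (att s))
         (covered : ∀ i j → i ≢ j → ∃ λ s → att s ≡ (i , j))
         {t Δ : ℕ} (ι : Fin t → Fin k) (ι-injective : Injective _≡_ _≡_ ι)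
         (heavy : ∀ i j → i ≢ j → Σ (Fin (Δ + Δ) → Fin m) λ h → Injective _≡_ _≡_ h × (∀ x → att (h x) ≡ (ι i , ι j)))
         where
  open Hedgehog att att≢

  module _ {N : ℕ} (g : Graph N) (sparse : Sparse k t Δ g) where
    open Sparse sparse

    ¬copy-blue : ¬ Copy blue (colouring g) hedgehog
    ¬copy-blue (f , f-injective , all) = contradiction
      (trans (sym (noIndependent (range b) (∣range∣ (↑ˡ-injective m _ _ ∘ f-injective)))) (range-homogeneous false g b nonadjacent)) λ ()
      where
      b : Fin k → Fin N
      b i = f (i ↑ˡ m)
      nonadjacent : ∀ i j → i ≢ j → lookup (neighbours g (b i)) (b j) ≡ false
      nonadjacent i j i≢j with covered i j i≢j
      ... | s , refl = ∉⇒lookup≡false λ bj∈ → colouring-blue g (All.lookup all (∈-tabulate⁺ s))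
        (b i , b j , ∈-image⁺ f (body₁∈edge s) , ∈-image⁺ f (body₂∈edge s) , bj∈)

    -- A red triple contains an edge of the graph. It is no loop, and it does not join the two body
    -- vertices, so the spike is one of its ends.
    spikeAdjacent : ∀ (f : Fin (k + m) → Fin N) s → let i = proj₁ (att s) ; j = proj₂ (att s) in
      ContainsEdge g (image f (edge s)) → f (j ↑ˡ m) ∉ neighbours g (f (i ↑ˡ m)) →
      f (k ↑ʳ s) ∈ neighbours g (f (i ↑ˡ m)) ∪ neighbours g (f (j ↑ˡ m))
    spikeAdjacent f s (_ , _ , x∈ , y∈ , xy) ij∉ with ∈-image⁻ f x∈ | ∈-image⁻ f y∈
    ... | x , x∈e , refl | y , y∈e , refl with ∈-edge⁻ x∈e | ∈-edge⁻ y∈e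
    ... | inj₁ refl        | inj₁ refl        = contradiction xy (∉neighbours g _)
    ... | inj₁ refl        | inj₂ (inj₁ refl) = contradiction xy ij∉
    ... | inj₁ refl        | inj₂ (inj₂ refl) = x∈p∪q⁺ (inj₁ xy)
    ... | inj₂ (inj₁ refl) | inj₁ refl        = contradiction (neighbours-sym g xy) ij∉
    ... | inj₂ (inj₁ refl) | inj₂ (inj₁ refl) = contradiction xy (∉neighbours g _)
    ... | inj₂ (inj₁ refl) | inj₂ (inj₂ refl) = x∈p∪q⁺ (inj₂ xy)
    ... | inj₂ (inj₂ refl) | inj₁ refl        = x∈p∪q⁺ (inj₁ (neighbours-sym g xy))
    ... | inj₂ (inj₂ refl) | inj₂ (inj₁ refl) = x∈p∪q⁺ (inj₂ (neighbours-sym g xy))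
    ... | inj₂ (inj₂ refl) | inj₂ (inj₂ refl) = contradiction xy (∉neighbours g _)

    ¬copy-red : ¬ Copy red (colouring g) hedgehog
    ¬copy-red (f , f-injective , all)
      with any? (λ i → any? λ j → ¬? (i ≟ᶠ j) ×-dec ¬? (f (ι j ↑ˡ m) ∈? neighbours g (f (ι i ↑ˡ m))))
    ... | no complete = contradiction
      (trans (sym (noClique (range b) (∣range∣ (ι-injective ∘ ↑ˡ-injective m _ _ ∘ f-injective)))) (range-homogeneous true g b adjacent)) λ ()
      where
      b : Fin t → Fin N
      b i = f (ι i ↑ˡ m)
      adjacent : ∀ i j → i ≢ j → lookup (neighbours g (b i)) (b j) ≡ true
      adjacent i j i≢j = []=⇒lookup (decidable-stable (b j ∈? neighbours g (b i)) λ bj∉ → complete (i , j , i≢j , bj∉))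
    ... | yes (i , j , i≢j , ij∉) with heavy i j i≢j
    ...   | h , h-injective , att-h = <⇒≱ (+-mono-< (maxDegree u) (maxDegree v)) (begin
      Δ + Δ                                    ≡⟨ ∣range∣ (h-injective ∘ ↑ʳ-injective k _ _ ∘ f-injective) ⟨
      ∣ range spike ∣                          ≤⟨ p⊆q⇒∣p∣≤∣q∣ inside ⟩
      ∣ neighbours g u ∪ neighbours g v ∣      ≤⟨ ∣p∪q∣≤∣p∣+∣q∣ (neighbours g u) (neighbours g v) ⟩
      ∣ neighbours g u ∣ + ∣ neighbours g v ∣  ∎)
      where
      open ≤-Reasoning
      u v : Fin N
      u = f (ι i ↑ˡ m)
      v = f (ι j ↑ˡ m)
      spike : Fin (Δ + Δ) → Fin N
      spike x = f (k ↑ʳ h x)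
      inside : ∀ {y} → y ∈ range spike → y ∈ neighbours g u ∪ neighbours g v
      inside y∈ with ∈-range⁻ spike y∈
      ... | x , refl = subst (λ p → f (proj₂ p ↑ˡ m) ∉ neighbours g (f (proj₁ p ↑ˡ m)) →
                                    spike x ∈ neighbours g (f (proj₁ p ↑ˡ m)) ∪ neighbours g (f (proj₂ p ↑ˡ m)))
                             (att-h x) (spikeAdjacent f (h x) (colouring-red g (All.lookup all (∈-tabulate⁺ (h x))))) ij∉

    sparse⇒¬arrows : ¬ Arrows N hedgehog hedgehog
    sparse⇒¬arrows arrows = [ ¬copy-blue , ¬copy-red ]′ (arrows (colouring g))

module Attachment (k t Δ ρ : ℕ) (ι : Fin t → Fin k) (d₁ d₂ : Fin k) (d₁≢d₂ : d₁ ≢ d₂) where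

  w spikes : ℕ
  w = Δ + Δ
  spikes = k * k + (w * (t * t) + ρ)

  heavyPair : Fin (w * (t * t)) → Fin k × Fin k
  heavyPair y = Product.map ι ι (remQuot {t} t (proj₂ (remQuot {w} (t * t) y)))

  -- One spike for each ordered pair, w further ones for each ordered pair of
  -- the t vertices picked by ι, and ρ spikes to reach the required order.
  -- Pairs (i , i) also occur here; distinct replaces them by (d₁ , d₂).
  pair : Fin spikes → Fin k × Fin k
  pair = [ remQuot k , [ heavyPair , const (d₁ , d₂) ]′ ∘ splitAt (w * (t * t)) ]′ ∘ splitAt (k * k)

  distinct : Fin k × Fin k → Fin k × Fin k
  distinct (i , j) = if does (i ≟ᶠ j) then (d₁ , d₂) else (i , j)

  distinct-≢ : ∀ p → proj₁ (distinct p) ≢ proj₂ (distinct p)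
  distinct-≢ (i , j) with i ≟ᶠ j
  ... | yes _  = d₁≢d₂
  ... | no i≢j = i≢j

  distinct-id : ∀ {i j} → i ≢ j → distinct (i , j) ≡ (i , j)
  distinct-id {i} {j} i≢j rewrite dec-false (i ≟ᶠ j) i≢j = refl

  att : Fin spikes → Fin k × Fin k
  att = distinct ∘ pair

  covered : ∀ i j → i ≢ j → ∃ λ s → att s ≡ (i , j)
  covered i j i≢j = combine i j ↑ˡ _ , trans (cong distinct
    (trans (cong [ remQuot k , _ ]′ (splitAt-↑ˡ (k * k) (combine i j) _)) (remQuot-combine i j))) (distinct-id i≢j)

  heavy : Injective _≡_ _≡_ ι → ∀ i j → i ≢ j →
    Σ (Fin w → Fin spikes) λ h → Injective _≡_ _≡_ h × (∀ x → att (h x) ≡ (ι i , ι j))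
  heavy ι-injective i j i≢j = h , h-injective , λ x → trans (cong distinct (pair-h x)) (distinct-id (i≢j ∘ ι-injective))
    where
    h : Fin w → Fin spikes
    h x = (k * k) ↑ʳ (combine x (combine i j) ↑ˡ ρ)
    h-injective : Injective _≡_ _≡_ h
    h-injective eq = combine-injectiveˡ _ _ _ _ (↑ˡ-injective ρ _ _ (↑ʳ-injective (k * k) _ _ eq))
    pair-h : ∀ x → pair (h x) ≡ (ι i , ι j)
    pair-h x rewrite splitAt-↑ʳ (k * k) (w * (t * t) + ρ) (combine x (combine i j) ↑ˡ ρ)
                   | splitAt-↑ˡ (w * (t * t)) (combine x (combine i j)) ρ =
      cong (Product.map ι ι) (trans (cong (remQuot t ∘ proj₂) (remQuot-combine x (combine i j))) (remQuot-combine i j))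

-- Choice of the parameters

^-distribʳ-* : ∀ m n o → (m * n) ^ o ≡ m ^ o * n ^ o
^-distribʳ-* m n zero    = refl
^-distribʳ-* m n (suc o) = trans (cong (m * n *_) (^-distribʳ-* m n o)) ([m*n]*[o*p]≡[m*o]*[n*p] m n (m ^ o) (n ^ o))

m*m≤n*n⇒m≤n : ∀ {m n} → m * m ≤ n * n → m ≤ n
m*m≤n*n⇒m≤n le = ≮⇒≥ λ n<m → <⇒≱ (*-mono-< n<m n<m) le

n<2^n : ∀ n → n < 2 ^ n
n<2^n zero    = s≤s z≤n
n<2^n (suc n) = ≤-trans (s≤s (n<2^n n)) (+-mono-≤ (m^n>0 2 n) (≤-reflexive (sym (+-identityʳ (2 ^ n)))))

1+x≤x+x : ∀ {x} → 1 ≤ x → 1 + x ≤ x + x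
1+x≤x+x {x} = +-monoˡ-≤ x

-- This is (1 + 1/p)^j ≥ 1 + j/p, multiplied by p^(j+1).
bernoulli : ∀ p j → p ^ j * (p + j) ≤ suc p ^ j * p
bernoulli p zero    = ≤-reflexive (cong (_+ 0) (+-identityʳ p))
bernoulli p (suc j) = begin
  p * p ^ j * (p + suc j)          ≤⟨ m≤m+n _ (p ^ j * j) ⟩
  p * p ^ j * (p + suc j) + p ^ j * j ≡⟨ rearrange p (p ^ j) j ⟩
  suc p * (p ^ j * (p + j))        ≤⟨ *-monoʳ-≤ (suc p) (bernoulli p j) ⟩
  suc p * (suc p ^ j * p)          ≡⟨ *-assoc (suc p) (suc p ^ j) p ⟨
  suc p ^ suc j * p                ∎
  where
  open ≤-Reasoning
  rearrange : ∀ p x j → p * x * (p + suc j) + x * j ≡ suc p * (x * (p + j))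
  rearrange = solve-∀

-- In terms of q = p + 1 this is (1 - 1/q)^q ≤ 1/2, as Bernoulli gives (1 + 1/p)^q ≥ 1 + q/p ≥ 2. It
-- bounds the probability of `q` missing edges.
2*p^q≤q^q : ∀ p → 2 * p ^ suc p ≤ suc p ^ suc p
2*p^q≤q^q zero      = z≤n
2*p^q≤q^q p@(suc _) = *-cancelʳ-≤ _ _ p (begin
  2 * p ^ suc p * p            ≡⟨ rearrange (p ^ suc p) p ⟩
  p ^ suc p * (p + p)          ≤⟨ *-monoʳ-≤ (p ^ suc p) (+-monoʳ-≤ p (n≤1+n p)) ⟩
  p ^ suc p * (p + suc p)      ≤⟨ bernoulli p (suc p) ⟩
  suc p ^ suc p * p            ∎)
  where
  open ≤-Reasoning
  rearrange : ∀ x p → 2 * x * p ≡ x * (p + p)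
  rearrange = solve-∀

-- This is (1 - 1/(q+1))^j ≥ 1 - j/(q+1) with denominators cleared; `a` stands for q + 1 - j without
-- truncated subtraction.
bernoulli⁻ : ∀ q j a → a + j ≡ suc q → suc q ^ j * a ≤ q ^ j * suc q
bernoulli⁻ q zero    a eq = ≤-reflexive (cong (_+ 0) (trans (sym (+-identityʳ a)) eq))
bernoulli⁻ q (suc j) a eq = begin
  suc q * suc q ^ j * a          ≡⟨ rearrange q (suc q ^ j) a ⟩
  suc q ^ j * (a + q * a)        ≤⟨ *-monoʳ-≤ (suc q ^ j) (+-monoˡ-≤ (q * a) a≤q) ⟩
  suc q ^ j * (q + q * a)        ≡⟨ rearrange′ q (suc q ^ j) a ⟩
  q * (suc q ^ j * suc a)        ≤⟨ *-monoʳ-≤ q (bernoulli⁻ q j (suc a) (trans (sym (+-suc a j)) eq)) ⟩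
  q * (q ^ j * suc q)            ≡⟨ *-assoc q (q ^ j) (suc q) ⟨
  q ^ suc j * suc q              ∎
  where
  open ≤-Reasoning
  a≤q : a ≤ q
  a≤q = ≤-trans (m≤m+n a j) (≤-reflexive (suc-injective (trans (sym (+-suc a j)) eq)))
  rearrange : ∀ q x a → suc q * x * a ≡ x * (a + q * a)
  rearrange = solve-∀
  rearrange′ : ∀ q x a → x * (q + q * a) ≡ q * (x * suc a)
  rearrange′ = solve-∀

[1+q]^j≤2*q^j : ∀ j → suc (j + j) ^ j ≤ 2 * (j + j) ^ j
[1+q]^j≤2*q^j j = *-cancelʳ-≤ _ _ (suc q) (begin
  suc q ^ j * suc q        ≤⟨ *-monoʳ-≤ (suc q ^ j) (s≤s (+-monoʳ-≤ j (n≤1+n j))) ⟩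
  suc q ^ j * (suc j + suc j) ≡⟨ rearrange (suc q ^ j) j ⟩
  2 * (suc q ^ j * suc j)  ≤⟨ *-monoʳ-≤ 2 (bernoulli⁻ q j (suc j) refl) ⟩
  2 * (q ^ j * suc q)      ≡⟨ *-assoc 2 (q ^ j) (suc q) ⟨
  2 * q ^ j * suc q        ∎)
  where
  open ≤-Reasoning
  q : ℕ
  q = j + j
  rearrange : ∀ x j → x * (suc j + suc j) ≡ 2 * (x * suc j)
  rearrange = solve-∀

-- For odd size the binomial coefficient is a product without halving. This is why the body gets an
-- odd number of vertices.
pairs-odd : ∀ x → pairs (suc (x + x)) ≡ suc (x + x) * x
pairs-odd zero    = refl
pairs-odd (suc x) rewrite +-suc x x = trans (cong (λ y → suc (suc (x + x)) + (suc (x + x) + y)) (pairs-odd x)) (rearrange x)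
  where
  rearrange : ∀ x → suc (suc (x + x)) + (suc (x + x) + suc (x + x) * x) ≡ suc (suc (suc (x + x))) * suc x
  rearrange = solve-∀

-- There are at most M^k sets, each independent with probability (1 - 1/q)^(qΛk) ≤ 2^(-Λk), because
-- a k-set has kx = qΛk pairs. As M ≤ 2^Λ / 4, the expected number is at most 4^(-k).
independent-bound : ∀ p M Λ → 4 * M ≤ 2 ^ Λ → let x = suc p * Λ ; k = suc (x + x) in
  4 * M ^ k * p ^ pairs k ≤ suc p ^ pairs k
independent-bound p M Λ small = begin
  4 * M ^ k * p ^ pairs k        ≤⟨ *-monoˡ-≤ (p ^ pairs k) (*-monoˡ-≤ (M ^ k) 4≤4^k) ⟩
  4 ^ k * M ^ k * p ^ pairs k    ≡⟨ cong₂ _*_ (sym (^-distribʳ-* 4 M k)) (trans (cong (p ^_) exponent) (sym (^-*-assoc p q (Λ * k)))) ⟩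
  (4 * M) ^ k * (p ^ q) ^ (Λ * k) ≤⟨ *-monoˡ-≤ _ (^-monoˡ-≤ k small) ⟩
  (2 ^ Λ) ^ k * (p ^ q) ^ (Λ * k) ≡⟨ cong (_* (p ^ q) ^ (Λ * k)) (^-*-assoc 2 Λ k) ⟩
  2 ^ (Λ * k) * (p ^ q) ^ (Λ * k) ≡⟨ ^-distribʳ-* 2 (p ^ q) (Λ * k) ⟨
  (2 * p ^ q) ^ (Λ * k)          ≤⟨ ^-monoˡ-≤ (Λ * k) (2*p^q≤q^q p) ⟩
  (q ^ q) ^ (Λ * k)              ≡⟨ trans (^-*-assoc q q (Λ * k)) (cong (q ^_) (sym exponent)) ⟩
  q ^ pairs k                    ∎
  where
  open ≤-Reasoning
  q k : ℕ
  q = suc p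
  k = suc (q * Λ + q * Λ)
  4≤4^k : 4 ≤ 4 ^ k
  4≤4^k = m≤m*n 4 (4 ^ (q * Λ + q * Λ)) {{m^n≢0 4 (q * Λ + q * Λ)}}
  exponent : pairs k ≡ q * (Λ * k)
  exponent = trans (pairs-odd (q * Λ)) (rearrange q Λ k)
    where
    rearrange : ∀ q Λ k → k * (q * Λ) ≡ q * (Λ * k)
    rearrange = solve-∀

-- With q = 2j, a block of j factors 1 + 1/q is at most 2, so the mean of 2 to the power of a degree
-- is at most 2^u. The union over all vertices costs the further Λ in the exponent.
degree-bound : ∀ j u Λ M .{{_ : NonZero j}} → 4 * M ≤ 2 ^ Λ → M ≤ j * u → let q = j + j in
  4 * M * suc q ^ M ≤ 2 ^ (u + Λ) * q ^ M
degree-bound j@(suc _) u Λ M small M≤ju with m≤n⇒∃[o]m+o≡n M≤ju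
... | o , M+o≡ju = begin
  4 * M * suc q ^ M          ≤⟨ *-mono-≤ small growth ⟩
  2 ^ Λ * (2 ^ u * q ^ M)    ≡⟨ rearrange (2 ^ Λ) (2 ^ u) (q ^ M) ⟩
  2 ^ u * 2 ^ Λ * q ^ M      ≡⟨ cong (_* q ^ M) (^-distribˡ-+-* 2 u Λ) ⟨
  2 ^ (u + Λ) * q ^ M        ∎
  where
  open ≤-Reasoning
  q : ℕ
  q = j + j
  rearrange : ∀ a b c → a * (b * c) ≡ b * a * c
  rearrange = solve-∀
  growth : suc q ^ M ≤ 2 ^ u * q ^ M
  -- The factor `q ^ o` fills the exponent up to `j * u`, which splits into `u` blocks of length
  -- `j`.
  growth = *-cancelʳ-≤ _ _ (q ^ o) {{m^n≢0 q o}} (begin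
    suc q ^ M * q ^ o        ≤⟨ *-monoʳ-≤ (suc q ^ M) (^-monoˡ-≤ o (n≤1+n q)) ⟩
    suc q ^ M * suc q ^ o    ≡⟨ ^-distribˡ-+-* (suc q) M o ⟨
    suc q ^ (M + o)          ≡⟨ cong (suc q ^_) M+o≡ju ⟩
    suc q ^ (j * u)          ≡⟨ ^-*-assoc (suc q) j u ⟨
    (suc q ^ j) ^ u          ≤⟨ ^-monoˡ-≤ u ([1+q]^j≤2*q^j j) ⟩
    (2 * q ^ j) ^ u          ≡⟨ ^-distribʳ-* 2 (q ^ j) u ⟩
    2 ^ u * (q ^ j) ^ u      ≡⟨ cong (2 ^ u *_) (^-*-assoc q j u) ⟩
    2 ^ u * q ^ (j * u)      ≡⟨ cong (λ e → 2 ^ u * q ^ e) M+o≡ju ⟨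
    2 ^ u * q ^ (M + o)      ≡⟨ cong (2 ^ u *_) (^-distribˡ-+-* q M o) ⟩
    2 ^ u * (q ^ M * q ^ o)  ≡⟨ *-assoc (2 ^ u) (q ^ M) (q ^ o) ⟨
    2 ^ u * q ^ M * q ^ o    ∎)

clique-bound : ∀ q M a b t → 4 ≤ q ^ a → M ≤ q ^ b → 4 * M ^ t ≤ q ^ (a + b * t)
clique-bound q M a b t 4≤q^a M≤q^b = begin
  4 * M ^ t              ≤⟨ *-mono-≤ 4≤q^a (^-monoˡ-≤ t M≤q^b) ⟩
  q ^ a * (q ^ b) ^ t    ≡⟨ cong (q ^ a *_) (^-*-assoc q b t) ⟩
  q ^ a * q ^ (b * t)    ≡⟨ ^-distribˡ-+-* q a (b * t) ⟨
  q ^ (a + b * t)        ∎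
  where open ≤-Reasoning

-- Rounding, growth and the parameters

-- Downward search from `b`. It serves as the integer part of a logarithm, of a quotient and of a
-- scaled square root.
floorInverse : ∀ (f : ℕ → ℕ) n → f 0 ≤ n → ∀ b → n < f b → ∃ λ x → f x ≤ n × n < f (suc x)
floorInverse f n f0≤n zero    n<f0 = contradiction f0≤n (<⇒≱ n<f0)
floorInverse f n f0≤n (suc b) n<f with f b ≤? n
... | yes fb≤n = b , fb≤n , n<f
... | no  fb≰n = floorInverse f n f0≤n b (≰⇒> fb≰n)

≤-induction : ∀ {P : ℕ → Set} {c} → P c → (∀ x → c ≤ x → P x → P (suc x)) → ∀ {x} → c ≤ x → P x
≤-induction {P} {c} base step {x} c≤x with m≤n⇒∃[o]m+o≡n c≤x
... | d , refl = go d
  where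
  go : ∀ d → P (c + d)
  go zero    = subst P (sym (+-identityʳ c)) base
  go (suc d) = subst P (sym (+-suc c d)) (step (c + d) (m≤m+n c d) (go d))

-- At ℓ = 64 the sides are 2^48 and 2^64, and afterwards the left side grows by at most (65/64)^4 ≤
-- 2. This absorbs all logarithmic factors and is the source of the threshold `2 ^ 64`.
[64ℓ]^4≤2^ℓ : ∀ {ℓ} → 64 ≤ ℓ → (64 * ℓ) ^ 4 ≤ 2 ^ ℓ
[64ℓ]^4≤2^ℓ = ≤-induction {λ ℓ → (64 * ℓ) ^ 4 ≤ 2 ^ ℓ} (toWitness {a? = (64 * 64) ^ 4 ≤? 2 ^ 64} _) step
  where
  open ≤-Reasoning
  step : ∀ x → 64 ≤ x → (64 * x) ^ 4 ≤ 2 ^ x → (64 * suc x) ^ 4 ≤ 2 ^ suc x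
  step x 64≤x ih = begin
    (64 * suc x) ^ 4          ≡⟨ cong (_^ 4) (*-suc 64 x) ⟩
    (64 + 64 * x) ^ 4         ≤⟨ ^-monoˡ-≤ 4 (+-monoˡ-≤ (64 * x) 64≤x) ⟩
    (65 * x) ^ 4              ≡⟨ ^-distribʳ-* 65 x 4 ⟩
    65 ^ 4 * x ^ 4            ≤⟨ *-monoˡ-≤ (x ^ 4) (toWitness {a? = 65 ^ 4 ≤? 2 * 64 ^ 4} _) ⟩
    2 * 64 ^ 4 * x ^ 4        ≡⟨ *-assoc 2 (64 ^ 4) (x ^ 4) ⟩
    2 * (64 ^ 4 * x ^ 4)      ≡⟨ cong (2 *_) (^-distribʳ-* 64 x 4) ⟨
    2 * (64 * x) ^ 4          ≤⟨ *-monoʳ-≤ 2 ih ⟩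
    2 ^ suc x                 ∎

-- Write s = a / (d + 1). From s² ≤ n³ and the hypothesis, a is at most (C + 1)ℓR(d + 1) after
-- taking square roots, and 2^ℓ ≤ n turns the power of 2 into a power of n.
lowerBound : ∀ C n R ℓ → 2 ^ ℓ ≤ n → n ^ 3 ≤ (suc C * (ℓ * R)) * (suc C * (ℓ * R)) → LowerBound (mkℚᵘ (ℤ.+ 1) C) n R
lowerBound C n R ℓ 2^ℓ≤n n³≤ (mkℚᵘ (-[1+ _ ]) d) () _
lowerBound C n R ℓ 2^ℓ≤n n³≤ (mkℚᵘ (ℤ.+ a) d) _ (*≤* le) = begin
  2 ^ ℤ.∣ ℤ.+ 1 ℤ.* ℤ.+ a ∣             ≡⟨ cong (2 ^_) (trans (ℤ.abs-* (ℤ.+ 1) (ℤ.+ a)) (*-identityˡ a)) ⟩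
  2 ^ a                             ≤⟨ ^-monoʳ-≤ 2 a≤ ⟩
  2 ^ (suc C * (ℓ * R) * suc d)     ≡⟨ cong (2 ^_) (rearrange (suc C) ℓ R (suc d)) ⟩
  2 ^ (ℓ * (R * (suc C * suc d)))   ≡⟨ ^-*-assoc 2 ℓ (R * (suc C * suc d)) ⟨
  (2 ^ ℓ) ^ (R * (suc C * suc d))   ≤⟨ ^-monoˡ-≤ (R * (suc C * suc d)) 2^ℓ≤n ⟩
  n ^ (R * (suc C * suc d))         ≡⟨ ^-*-assoc n R (suc C * suc d) ⟨
  (n ^ R) ^ (suc C * suc d)         ∎
  where
  open ≤-Reasoning
  rearrange : ∀ C ℓ R d → C * (ℓ * R) * d ≡ ℓ * (R * (C * d))
  rearrange = solve-∀
  square : ∀ x d → x * x * (d * d) ≡ x * d * (x * d)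
  square = solve-∀
  a²≤ : a * a ≤ n ^ 3 * (suc d * suc d)
  a²≤ = ℤ.drop‿+≤+ (subst₂ ℤ._≤_ (trans (ℤ.*-identityʳ (ℤ.+ a ℤ.* ℤ.+ a)) (sym (ℤ.pos-* a a)))
                                 (sym (ℤ.pos-* (n ^ 3) (suc d * suc d))) le)
  a≤ : a ≤ suc C * (ℓ * R) * suc d
  a≤ = m*m≤n*n⇒m≤n (≤-trans a²≤ (≤-trans (*-monoˡ-≤ (suc d * suc d) n³≤) (≤-reflexive (square (suc C * (ℓ * R)) (suc d)))))

-- Rounding down loses at most a factor 2, since the quotient is at least 1. Hence 1024 becomes
-- 2048, and likewise 32 becomes 64 for the square root below.
floor-* : ∀ c n → 1 ≤ c → c ≤ n → ∃ λ u → 1 ≤ u × c * u ≤ n × n ≤ (c + c) * u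
floor-* c n 1≤c c≤n with floorInverse (c *_) n (≤-trans (≤-reflexive (*-zeroʳ c)) z≤n) (suc n) (m≤n*m (suc n) c {{>-nonZero 1≤c}})
... | u , upper , n<c*[1+u] = u , 1≤u , upper , (begin
  n            ≤⟨ <⇒≤ n<c*[1+u] ⟩
  c * suc u    ≤⟨ *-monoʳ-≤ c (1+x≤x+x 1≤u) ⟩
  c * (u + u)  ≡⟨ rearrange c u ⟩
  (c + c) * u  ∎)
  where
  open ≤-Reasoning
  1≤u : 1 ≤ u
  1≤u = ≮⇒≥ λ u<1 → <⇒≱ n<c*[1+u] (≤-trans (*-monoʳ-≤ c u<1) (≤-trans (≤-reflexive (*-identityʳ c)) c≤n))
  rearrange : ∀ c u → c * (u + u) ≡ (c + c) * u
  rearrange = solve-∀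

floor-*² : ∀ c n → 1 ≤ c → c * c ≤ n → ∃ λ j → 1 ≤ j × (c * j) * (c * j) ≤ n × n ≤ ((c + c) * j) * ((c + c) * j)
floor-*² c n 1≤c c²≤n with floorInverse (λ x → (c * x) * (c * x)) n (≤-trans (≤-reflexive (cong₂ _*_ (*-zeroʳ c) (*-zeroʳ c))) z≤n) (suc n) big
  where
  1≤c*[1+n] : 1 ≤ c * suc n
  1≤c*[1+n] = *-mono-≤ 1≤c (s≤s (z≤n {n}))
  big : n < (c * suc n) * (c * suc n)
  big = ≤-trans (m≤n*m (suc n) c {{>-nonZero 1≤c}}) (m≤m*n (c * suc n) (c * suc n) {{>-nonZero 1≤c*[1+n]}})
... | j , upper , n<[1+j] = j , 1≤j , upper , (begin
  n                                  ≤⟨ <⇒≤ n<[1+j] ⟩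
  (c * suc j) * (c * suc j)          ≤⟨ *-mono-≤ doubled doubled ⟩
  ((c + c) * j) * ((c + c) * j)      ∎)
  where
  open ≤-Reasoning
  rearrange : ∀ c u → c * (u + u) ≡ (c + c) * u
  rearrange = solve-∀
  c*1≤c : ∀ {x} → x ≤ 1 → c * x ≤ c
  c*1≤c x≤1 = ≤-trans (*-monoʳ-≤ c x≤1) (≤-reflexive (*-identityʳ c))
  1≤j : 1 ≤ j
  1≤j = ≮⇒≥ λ j<1 → <⇒≱ n<[1+j] (≤-trans (*-mono-≤ (c*1≤c j<1) (c*1≤c j<1)) c²≤n)
  doubled : c * suc j ≤ (c + c) * j
  doubled = ≤-trans (*-monoʳ-≤ c (1+x≤x+x 1≤j)) (≤-reflexive (rearrange c j))

-- The random graphs have density 1 / 2j, at most j * u vertices and maximum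
-- degree below u + 3 * ℓ, and the body has 12 * ℓ * j + 1 vertices.
record Parameters (n : ℕ) : Set where
  field
    ℓ j u    : ℕ
    64≤ℓ     : 64 ≤ ℓ
    2^ℓ≤n    : 2 ^ ℓ ≤ n
    n<2^1+ℓ  : n < 2 ^ suc ℓ
    ℓ-small  : (64 * ℓ) ^ 4 ≤ n
    1≤j      : 1 ≤ j
    j-upper  : (32 * ℓ * j) * (32 * ℓ * j) ≤ n
    j-lower  : n ≤ (64 * ℓ * j) * (64 * ℓ * j)
    n≤j^4    : n ≤ j ^ 4
    1≤u      : 1 ≤ u
    u-upper  : 1024 * u ≤ n
    u-lower  : n ≤ 2048 * u

-- Squaring gives n² ≤ b⁴j⁴ ≤ n j⁴. The result bounds the order by a power of the inverse density
-- for the clique estimate, and it makes `j` unbounded for the superlinear growth.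
fourth-root-bound : ∀ {n} b j → 1 ≤ n → n ≤ (b * j) * (b * j) → b ^ 4 ≤ n → n ≤ j ^ 4
fourth-root-bound {n} b j 1≤n lower b^4≤n = *-cancelˡ-≤ n {{>-nonZero 1≤n}} (begin
  n * n                                       ≤⟨ *-mono-≤ lower lower ⟩
  (b * j) * (b * j) * ((b * j) * (b * j))     ≡⟨ rearrange b j ⟩
  b ^ 4 * j ^ 4                               ≤⟨ *-monoˡ-≤ (j ^ 4) b^4≤n ⟩
  n * j ^ 4                                   ∎)
  where
  open ≤-Reasoning
  rearrange : ∀ b j → (b * j) * (b * j) * ((b * j) * (b * j)) ≡ b * (b * (b * (b * 1))) * (j * (j * (j * (j * 1))))
  rearrange = solve-∀

b*b≤b^4 : ∀ b → b * b ≤ b ^ 4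
b*b≤b^4 zero = z≤n
b*b≤b^4 b@(suc _) = ≤-trans (≤-reflexive (cong (b *_) (sym (*-identityʳ b)))) (^-monoʳ-≤ b {2} {4} (m≤m+n 2 2))

parameters : ∀ n → 2 ^ 64 ≤ n → Parameters n
parameters n n-large = choose
  (floorInverse (2 ^_) n 1≤n n (n<2^n n))
  (floor-* 1024 n (m≤m+n 1 1023) (≤-trans (toWitness {a? = 1024 ≤? 2 ^ 64} _) n-large))
  where
  1≤n : 1 ≤ n
  1≤n = ≤-trans (toWitness {a? = 1 ≤? 2 ^ 64} _) n-large
  choose : (∃ λ ℓ → 2 ^ ℓ ≤ n × n < 2 ^ suc ℓ) → (∃ λ u → 1 ≤ u × 1024 * u ≤ n × n ≤ 2048 * u) → Parameters n
  choose (ℓ , 2^ℓ≤n , n<2^1+ℓ) (u , 1≤u , u-upper , u-lower) = choose′ (floor-*² (32 * ℓ) n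
      (*-mono-≤ {1} {32} (m≤m+n 1 31) (≤-trans (m≤m+n 1 63) 64≤ℓ))
      (≤-trans (*-mono-≤ half half) (≤-trans (b*b≤b^4 (64 * ℓ)) ℓ-small)))
    where
    64≤ℓ : 64 ≤ ℓ
    64≤ℓ = ≮⇒≥ λ ℓ<64 → <⇒≱ (<-≤-trans n<2^1+ℓ (^-monoʳ-≤ 2 ℓ<64)) n-large
    ℓ-small : (64 * ℓ) ^ 4 ≤ n
    ℓ-small = ≤-trans ([64ℓ]^4≤2^ℓ 64≤ℓ) 2^ℓ≤n
    half : 32 * ℓ ≤ 64 * ℓ
    half = *-monoˡ-≤ ℓ (m≤m+n 32 32)
    choose′ : (∃ λ j → 1 ≤ j × (32 * ℓ * j) * (32 * ℓ * j) ≤ n × n ≤ ((32 * ℓ + 32 * ℓ) * j) * ((32 * ℓ + 32 * ℓ) * j)) → Parameters n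
    choose′ (j , 1≤j , j-upper , lower) = record
      { ℓ = ℓ ; j = j ; u = u ; 64≤ℓ = 64≤ℓ ; 2^ℓ≤n = 2^ℓ≤n ; n<2^1+ℓ = n<2^1+ℓ ; ℓ-small = ℓ-small
      ; 1≤j = 1≤j ; j-upper = j-upper ; j-lower = j-lower ; n≤j^4 = fourth-root-bound (64 * ℓ) j 1≤n j-lower ℓ-small
      ; 1≤u = 1≤u ; u-upper = u-upper ; u-lower = u-lower }
      where
      j-lower : n ≤ (64 * ℓ * j) * (64 * ℓ * j)
      j-lower = subst (λ b → n ≤ (b * j) * (b * j)) (sym (*-distribʳ-+ ℓ 32 32)) lower

-- The hedgehog of order n

record RamseyHedgehog (n N : ℕ) : Set where
  field
    graph       : ThreeGraph n
    isHedgehog  : IsGeneralisedHedgehog graph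
    degenerate  : Degenerate 1 graph
    ¬arrows     : ∀ M → M ≤ N → ¬ Arrows M graph graph

ramseyHedgehog : ∀ k t Δ ρ N → 2 ≤ t → t ≤ k → (∀ M → M ≤ N → ∃ λ (g : Graph M) → Sparse k t Δ g) →
  RamseyHedgehog (k + (k * k + ((Δ + Δ) * (t * t) + ρ))) N
ramseyHedgehog k t@(suc (suc _)) Δ ρ N (s≤s (s≤s _)) t≤k sparse = record
  { graph      = Hedgehog.hedgehog att (distinct-≢ ∘ pair)
  ; isHedgehog = Hedgehog.isHedgehog att (distinct-≢ ∘ pair)
  ; degenerate = Hedgehog.degenerate att (distinct-≢ ∘ pair)
  ; ¬arrows    = λ M M≤N → let g , s = sparse M M≤N in
      sparse⇒¬arrows att (distinct-≢ ∘ pair) covered ι ι-injective (heavy ι-injective) g s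
  }
  where
  ι : Fin t → Fin k
  ι i = inject≤ i t≤k
  ι-injective : Injective _≡_ _≡_ ι
  ι-injective = inject≤-injective t≤k t≤k _ _
  0≢1 : ι zero ≢ ι (suc zero)
  0≢1 eq with ι-injective eq
  ... | ()
  open Attachment k t Δ ρ ι (ι zero) (ι (suc zero)) 0≢1

-- For cliques, 4 ≤ q² and M ≤ q⁵ bound 4M^t by q^(2 + 5t). The least t for which this exponent is
-- at most t(t-1)/2 is 12, with 62 against 66.
sparse-graphs : ∀ p j u Λ t M → suc p ≡ j + j → 1 ≤ j → 2 + 5 * t ≤ pairs t → 4 * M ≤ 2 ^ Λ → M ≤ j * u → M ≤ j ^ 5 →
  ∃ λ (g : Graph M) → Sparse (suc (suc p * Λ + suc p * Λ)) t (u + Λ) g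
sparse-graphs p j u Λ t M q≡2j 1≤j t-large 4M≤ M≤ju M≤j^5 = RandomGraph.sparse-exists p M (suc (suc p * Λ + suc p * Λ)) t (u + Λ)
  (independent-bound p M Λ 4M≤)
  (≤-trans (clique-bound (suc p) M 2 5 t (^-monoˡ-≤ 2 2≤q) (≤-trans M≤j^5 (^-monoˡ-≤ 5 j≤q))) (^-monoʳ-≤ (suc p) t-large))
  (subst (λ q → 4 * M * suc q ^ M ≤ 2 ^ (u + Λ) * q ^ M) (sym q≡2j) (degree-bound j u Λ M {{>-nonZero 1≤j}} 4M≤ M≤ju))
  where
  j≤q : j ≤ suc p
  j≤q = ≤-trans (m≤m+n j j) (≤-reflexive (sym q≡2j))
  2≤q : 2 ≤ suc p
  2≤q = ≤-trans (+-mono-≤ 1≤j 1≤j) (≤-reflexive (sym q≡2j))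

m≤m*m : ∀ m → m ≤ m * m
m≤m*m zero      = z≤n
m≤m*m m@(suc _) = m≤m*n m m

module _ {n : ℕ} (P : Parameters n) where
  open Parameters P
  open ≤-Reasoning

  1≤ℓ : 1 ≤ ℓ
  1≤ℓ = ≤-trans (m≤m+n 1 63) 64≤ℓ

  j≤n : j ≤ n
  j≤n = begin
    j                               ≤⟨ m≤n*m j (32 * ℓ) {{>-nonZero (*-mono-≤ {1} {32} (m≤m+n 1 31) 1≤ℓ)}} ⟩
    32 * ℓ * j                      ≤⟨ m≤m*m (32 * ℓ * j) ⟩
    (32 * ℓ * j) * (32 * ℓ * j)     ≤⟨ j-upper ⟩
    n                               ∎

  u≤n : u ≤ n
  u≤n = ≤-trans (m≤n*m u 1024) u-upper

  -- Both `j` and `u` are at most n < 2^(ℓ+1), so 4M ≤ 2^(2ℓ+4). Hence `3 * ℓ` is the value taken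
  -- for Λ.
  4M≤8^ℓ : ∀ {M} → M ≤ j * u → 4 * M ≤ 2 ^ (3 * ℓ)
  4M≤8^ℓ {M} M≤ju = begin
    4 * M                                  ≤⟨ *-monoʳ-≤ 4 (≤-trans M≤ju (*-mono-≤ (≤-trans j≤n (<⇒≤ n<2^1+ℓ)) (≤-trans u≤n (<⇒≤ n<2^1+ℓ)))) ⟩
    2 ^ 2 * (2 ^ suc ℓ * 2 ^ suc ℓ)        ≡⟨ cong (2 ^ 2 *_) (^-distribˡ-+-* 2 (suc ℓ) (suc ℓ)) ⟨
    2 ^ 2 * 2 ^ (suc ℓ + suc ℓ)            ≡⟨ ^-distribˡ-+-* 2 2 (suc ℓ + suc ℓ) ⟨
    2 ^ (2 + (suc ℓ + suc ℓ))              ≡⟨ cong (2 ^_) (rearrange ℓ) ⟩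
    2 ^ (4 + 2 * ℓ)                        ≤⟨ ^-monoʳ-≤ 2 (+-monoˡ-≤ (2 * ℓ) (≤-trans (m≤m+n 4 60) 64≤ℓ)) ⟩
    2 ^ (3 * ℓ)                            ∎
    where
    rearrange : ∀ ℓ → 2 + (suc ℓ + suc ℓ) ≡ 4 + 2 * ℓ
    rearrange = solve-∀

  M≤j^5 : ∀ {M} → M ≤ j * u → M ≤ j ^ 5
  M≤j^5 M≤ju = ≤-trans M≤ju (*-monoʳ-≤ j (≤-trans u≤n n≤j^4))

  -- With y = ℓj, k ≤ 13y makes the left side at most 4(13 + 169)y² = 728y², and 728 + 296 = 32².
  -- The body and its pairs thus use a quarter of the vertices.
  body-bound : ∀ {k} → k ≡ suc (12 * (ℓ * j)) → 4 * (k + k * k) ≤ n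
  body-bound {k} k≡ = begin
    4 * (k + k * k)                       ≤⟨ *-monoʳ-≤ 4 (+-mono-≤ (≤-trans k≤13y (*-monoʳ-≤ 13 (m≤m*m y))) (*-mono-≤ k≤13y k≤13y)) ⟩
    4 * (13 * (y * y) + 13 * y * (13 * y)) ≤⟨ m≤m+n _ (296 * (y * y)) ⟩
    4 * (13 * (y * y) + 13 * y * (13 * y)) + 296 * (y * y) ≡⟨ collect ℓ j ⟩
    (32 * ℓ * j) * (32 * ℓ * j)           ≤⟨ j-upper ⟩
    n                                     ∎
    where
    y : ℕ
    y = ℓ * j
    k≤13y : k ≤ 13 * y
    k≤13y = ≤-trans (≤-reflexive k≡) (+-monoˡ-≤ (12 * y) (*-mono-≤ 1≤ℓ 1≤j))
    collect : ∀ ℓ j → 4 * (13 * (ℓ * j * (ℓ * j)) + 13 * (ℓ * j) * (13 * (ℓ * j))) + 296 * (ℓ * j * (ℓ * j)) ≡ (32 * ℓ * j) * (32 * ℓ * j)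
    collect = solve-∀

  -- The remaining three quarters: the terms in `u` take at most 2n by the choice of 1024, and those
  -- in `ℓ` at most n, being below (64ℓ)².
  heavy-bound : let Δ = u + 3 * ℓ in 4 * ((Δ + Δ) * (12 * 12)) ≤ 3 * n
  heavy-bound = begin
    4 * ((u + 3 * ℓ + (u + 3 * ℓ)) * (12 * 12))   ≡⟨ expand u ℓ ⟩
    1152 * u + 3456 * ℓ                           ≤⟨ +-mono-≤ (*-monoˡ-≤ u (m≤m+n 1152 896)) (*-monoˡ-≤ ℓ (m≤m+n 3456 640)) ⟩
    2048 * u + 4096 * ℓ                           ≤⟨ +-mono-≤ u-part (*-monoʳ-≤ 4096 (m≤m*m ℓ)) ⟩
    2 * n + 4096 * (ℓ * ℓ)                        ≡⟨ cong (_+_ (2 * n)) (regroup ℓ) ⟩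
    2 * n + 64 * ℓ * (64 * ℓ)                     ≤⟨ +-monoʳ-≤ (2 * n) (≤-trans (b*b≤b^4 (64 * ℓ)) ℓ-small) ⟩
    2 * n + n                                     ≡⟨ +-comm (2 * n) n ⟩
    3 * n                                         ∎
    where
    expand : ∀ u ℓ → 4 * ((u + 3 * ℓ + (u + 3 * ℓ)) * (12 * 12)) ≡ 1152 * u + 3456 * ℓ
    expand = solve-∀
    regroup : ∀ ℓ → 4096 * (ℓ * ℓ) ≡ 64 * ℓ * (64 * ℓ)
    regroup = solve-∀
    u-part : 2048 * u ≤ 2 * n
    u-part = ≤-trans (≤-reflexive (*-assoc 2 1024 u)) (*-monoʳ-≤ 2 u-upper)

  order-bound : ∀ {k} → k ≡ suc (12 * (ℓ * j)) → let Δ = u + 3 * ℓ in k + k * k + (Δ + Δ) * (12 * 12) ≤ n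
  order-bound {k} k≡ = *-cancelˡ-≤ 4 (begin
    4 * (k + k * k + X)        ≡⟨ *-distribˡ-+ 4 (k + k * k) X ⟩
    4 * (k + k * k) + 4 * X    ≤⟨ +-mono-≤ (body-bound k≡) heavy-bound ⟩
    4 * n                      ∎)
    where
    X : ℕ
    X = (u + 3 * ℓ + (u + 3 * ℓ)) * (12 * 12)

  hedgehog-exists : RamseyHedgehog n (j * u)
  -- Random edges have probability `1 / suc p`, so density 1 / 2j means that `p` is 2j - 1.
  hedgehog-exists = build (m≤n⇒∃[o]m+o≡n (+-mono-≤ 1≤j (z≤n {j})))
    where
    build : (∃ λ p → suc p ≡ j + j) → RamseyHedgehog n (j * u)
    build (p , q≡2j) = pad (m≤n⇒∃[o]m+o≡n (order-bound k≡))
      where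
      k Δ : ℕ
      k = suc (suc p * (3 * ℓ) + suc p * (3 * ℓ))
      Δ = u + 3 * ℓ
      k≡ : k ≡ suc (12 * (ℓ * j))
      k≡ = cong suc (trans (cong (λ q → q * (3 * ℓ) + q * (3 * ℓ)) q≡2j) (rearrange j ℓ))
        where
        rearrange : ∀ j ℓ → (j + j) * (3 * ℓ) + (j + j) * (3 * ℓ) ≡ 12 * (ℓ * j)
        rearrange = solve-∀
      12≤k : 12 ≤ k
      12≤k = ≤-trans (≤-trans (*-monoʳ-≤ 12 (*-mono-≤ 1≤ℓ 1≤j)) (n≤1+n (12 * (ℓ * j)))) (≤-reflexive (sym k≡))
      pad : (∃ λ ρ → k + k * k + (Δ + Δ) * (12 * 12) + ρ ≡ n) → RamseyHedgehog n (j * u)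
      pad (ρ , order) = subst (λ n → RamseyHedgehog n (j * u))
        (trans (regroup k (k * k) ((Δ + Δ) * (12 * 12)) ρ) order)
        (ramseyHedgehog k 12 Δ ρ (j * u) (m≤m+n 2 10) 12≤k
          λ M M≤ju → sparse-graphs p j u (3 * ℓ) 12 M q≡2j 1≤j (toWitness {a? = 2 + 5 * 12 ≤? pairs 12} _) (4M≤8^ℓ M≤ju) M≤ju (M≤j^5 M≤ju))
        where
        regroup : ∀ a b c d → a + (b + (c + d)) ≡ a + b + c + d
        regroup = solve-∀

-- One factor n is bounded through j² and the other two through u², so that the product becomes a
-- square containing `j * u`.
cube-bound : ∀ a b c n ℓ j u R → c ≡ a * b → n ≤ (a * ℓ * j) * (a * ℓ * j) → n ≤ b * u → j * u ≤ R →
  n ^ 3 ≤ (c * (ℓ * R)) * (c * (ℓ * R))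
cube-bound a b c n ℓ j u R refl n≤aℓj n≤bu ju≤R = begin
  n ^ 3                                                    ≡⟨ cong (λ y → n * (n * y)) (*-identityʳ n) ⟩
  n * (n * n)                                              ≤⟨ *-mono-≤ n≤aℓj (*-mono-≤ n≤bu n≤bu) ⟩
  (a * ℓ * j) * (a * ℓ * j) * (b * u * (b * u))            ≡⟨ rearrange a b ℓ j u ⟩
  (a * b * (ℓ * (j * u))) * (a * b * (ℓ * (j * u)))        ≤⟨ *-mono-≤ grow grow ⟩
  (a * b * (ℓ * R)) * (a * b * (ℓ * R))                    ∎
  where
  open ≤-Reasoning
  rearrange : ∀ a b ℓ j u → (a * ℓ * j) * (a * ℓ * j) * (b * u * (b * u)) ≡ (a * b * (ℓ * (j * u))) * (a * b * (ℓ * (j * u)))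
  rearrange = solve-∀
  grow : a * b * (ℓ * (j * u)) ≤ a * b * (ℓ * R)
  grow = *-monoʳ-≤ (a * b) (*-monoʳ-≤ ℓ ju≤R)

-- Superlinear growth and the final functions

Factors : ℕ → ℕ → ℕ → Set
Factors b n R = ∃ λ j → ∃ λ u → 1 ≤ u × n ≤ j ^ 4 × n ≤ b * u × j * u ≤ R

-- As R ≥ ju with u ≥ n / b and j ≥ n^(1/4), the ratio R / n is at least n^(1/4) / b; no logarithm
-- enters.
superlinear : ∀ b n₀ (R : ℕ → ℕ) → (∀ n → n₀ ≤ n → Factors b n (R n)) → ¬ IsO[n] R
superlinear b n₀ R factors (C , n₁ , linear) = refute (factors n (m≤n+m n₀ _)) (linear n (≤-trans (m≤m+n n₁ _) (m≤m+n _ n₀)))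
  where
  open ≤-Reasoning
  n : ℕ
  -- Beyond both thresholds and larger than (Cb)⁴, so that n ≤ j⁴ forces j > Cb.
  n = n₁ + suc ((C * b) ^ 4) + n₀
  refute : Factors b n (R n) → ¬ R n ≤ C * n
  refute (j , u , 1≤u , n≤j^4 , n≤bu , ju≤R) R≤Cn = <⇒≱ Cb<j (*-cancelʳ-≤ j (C * b) u {{>-nonZero 1≤u}} (begin
    j * u          ≤⟨ ju≤R ⟩
    R n            ≤⟨ R≤Cn ⟩
    C * n          ≤⟨ *-monoʳ-≤ C n≤bu ⟩
    C * (b * u)    ≡⟨ *-assoc C b u ⟨
    C * b * u      ∎))
    where
    Cb<j : C * b < j
    Cb<j = ≰⇒> λ j≤Cb → <⇒≱ (≤-trans (m≤n+m _ n₁) (m≤m+n _ n₀)) (≤-trans n≤j^4 (^-monoˡ-≤ 4 j≤Cb))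

record Witness (c : ℚᵘ) (b n : ℕ) : Set where
  field
    graph      : ThreeGraph n
    number     : ℕ
    isHedgehog : IsGeneralisedHedgehog graph
    isRamsey   : IsRamseyNumber graph graph number
    lower      : LowerBound c n number
    degenerate : Degenerate 1 graph
    factors    : Factors b n number

witness : ∀ C {n} (P : Parameters n) → suc C ≡ 64 * 2048 → let open Parameters P in
  (H : RamseyHedgehog n (j * u)) → let open RamseyHedgehog H in
  ∃ (IsRamseyNumber graph graph) → Witness (mkℚᵘ (ℤ.+ 1) C) 2048 n
witness C {n} P C≡ H (R , R-ramsey) = record
  { graph      = graph
  ; number     = R
  ; isHedgehog = isHedgehog
  ; isRamsey   = R-ramsey
  ; lower      = lowerBound C n R ℓ 2^ℓ≤n (cube-bound 64 2048 (suc C) n ℓ j u R C≡ j-lower u-lower ju≤R)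
  ; degenerate = degenerate
  ; factors    = j , u , 1≤u , n≤j^4 , u-lower , ju≤R
  }
  where
  open Parameters P
  open RamseyHedgehog H
  ju≤R : j * u ≤ R
  -- The failure to arrow is known for every order up to `j * u`, so it applies to the Ramsey number
  -- itself.
  ju≤R = ≮⇒≥ λ R<ju → ¬arrows R (<⇒≤ R<ju) (proj₁ R-ramsey)

emptyGraph : ∀ n → ThreeGraph n
emptyGraph n = record { edges = [] ; unique = [] ; uniform = [] }

from-witnesses : ∀ c b n₀ → (∀ n → n₀ ≤ n → Witness c b n) →
    Σ ((n : ℕ) → ThreeGraph n) λ H* → Σ (ℕ → ℕ) λ R →
    ((n : ℕ) → n₀ ≤ n →
    IsGeneralisedHedgehog (H* n)
    × IsRamseyNumber (H* n) (H* n) (R n)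
    × LowerBound c n (R n)
    × Degenerate 1 (H* n))
    × ¬ IsO[n] R
from-witnesses c b n₀ w = (λ n → H (n₀ ≤? n)) , (λ n → R (n₀ ≤? n)) , (λ n → properties (n₀ ≤? n)) ,
  superlinear b n₀ (λ n → R (n₀ ≤? n)) (λ n → factors (n₀ ≤? n))
  where
  H : ∀ {n} → Dec (n₀ ≤ n) → ThreeGraph n
  H (yes le) = Witness.graph (w _ le)
  -- Below `n₀` nothing is claimed, so the empty graph and the value 0 fill the gap.
  H (no _)   = emptyGraph _
  R : ∀ {n} → Dec (n₀ ≤ n) → ℕ
  R (yes le) = Witness.number (w _ le)
  R (no _)   = 0
  properties : ∀ {n} (d : Dec (n₀ ≤ n)) → n₀ ≤ n →
    IsGeneralisedHedgehog (H d) × IsRamseyNumber (H d) (H d) (R d) × LowerBound c n (R d) × Degenerate 1 (H d)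
  properties (yes le) _ = isHedgehog , isRamsey , lower , degenerate
    where open Witness (w _ le)
  properties (no n≱n₀) le = contradiction le n≱n₀
  factors : ∀ {n} (d : Dec (n₀ ≤ n)) → n₀ ≤ n → Factors b n (R d)
  factors (yes le) _ = Witness.factors (w _ le)
  factors (no n≱n₀) le = contradiction le n≱n₀

theorem1p1 : Σ ℚᵘ λ c → Positive c × (Σ ℕ λ n₀ →
    Σ ((n : ℕ) → ThreeGraph n) λ H* → Σ (ℕ → ℕ) λ R →
    ((n : ℕ) → n₀ ≤ n →
    IsGeneralisedHedgehog (H* n)
    × IsRamseyNumber (H* n) (H* n) (R n)
    × LowerBound c n (R n)
    × Degenerate 1 (H* n))
    × ¬ IsO[n] R)
-- `mkℚᵘ` stores the denominator minus one: c is 1 / 131072, where 131072 = 64 * 2048 combines the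
-- lower bounds for `j` and `u`.
theorem1p1 = mkℚᵘ (ℤ.+ 1) 131071 , _ , 2 ^ 64 , from-witnesses (mkℚᵘ (ℤ.+ 1) 131071) 2048 (2 ^ 64) λ n n-large →
  let P = parameters n n-large
      H = hedgehog-exists P
  in witness 131071 P refl H (ramseyNumber (RamseyHedgehog.graph H) (RamseyHedgehog.graph H))
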